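{- There is a constant $C$ such that in the 2-offer 3-uniform semirandom model there exists a strategy with the following property: for $n$ divisible by $2$, the hypergraph $H_t$ obtained after $t=Cn$ rounds asymptotically almost surely (with probability tending to $1$ as $n\to\infty$) contains a loose Hamilton cycle.
   Context: The $r$-offer $s$-uniform semirandom model: a player builds a sequence of $s$-uniform hypergraphs $H_0, H_1, H_2, \ldots$ on vertex set $[n]=\{1,\ldots,n\}$, with $H_0$ empty. In each round $t\ge 1$, a uniformly random set of $r$ vertices of $[n]$ is offered; the player, knowing the offered vertices and the entire history (including $H_{t-1}$), chooses $s-r$ further vertices, and the resulting $s$-set is added as a hyperedge to $H_{t-1}$ to form $H_t$. (The player may also ignore an offer, which still counts as a round.) A strategy is a rule for these choices. A loose Hamilton cycle in a 3-uniform hypergraph on $[n]$ ($n$ even) is a collection of $n/2$ hyperedges of the form $\{v_1,v_2,v_3\},\{v_3,v_4,v_5\},\ldots,\{v_{n-1},v_n,v_1\}$ for some ordering $v_1,\ldots,v_n$ of $[n]$; i.e., a cyclic sequence of hyperedges covering all vertices in which consecutive hyperedges share exactly one vertex and non-consecutive hyperedges are disjoint. -}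

module Defs where

open import Data.Nat using (ℕ; zero; suc)
open import Data.Fin using (Fin; _<_; _≟_)
open import Data.Fin.Subset using (Subset; ⁅_⁆; _∪_)
open import Data.Product using (Σ; _×_; _,_; ∃-syntax; proj₁; proj₂)
open import Data.Maybe using (Maybe; just; nothing)
open import Data.List using (List; []; _∷_; _∷ʳ_)
open import Data.List.Membership.Propositional using (_∈_)
open import Data.List.Relation.Unary.All using (All)
open import Data.List.Relation.Binary.Permutation.Propositional using (_↭_)
open import Relation.Binary.PropositionalEquality using (_≢_)

-- An offer in the 2-offer model: a 2-subset {a, b} of [n], represented
-- canonically as an ordered pair with a < b.  Offers are uniform over
-- these (n choose 2) pairs.
Offer : ℕ → Set
Offer n = Σ (Fin n × Fin n) λ p → proj₁ p < proj₂ p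

-- The player's answer to an offer {a,b}: a third vertex c distinct from
-- a and b (so {a,b,c} is a 3-set), or 'nothing' = ignore the offer.
Choice : {n : ℕ} → Offer n → Set
Choice {n} ((a , b) , _) = Σ (Fin n) λ c → (c ≢ a) × (c ≢ b)

Move : ℕ → Set
Move n = Σ (Offer n) λ o → Maybe (Choice o)

-- A (deterministic) strategy: given the full history of previous rounds
-- (oldest first) and the current offer, choose the answer.
Strategy : ℕ → Set
Strategy n = List (Move n) → (o : Offer n) → Maybe (Choice o)

play : {n : ℕ} → Strategy n → List (Move n) → List (Offer n) → List (Move n)
play σ h [] = h
play σ h (o ∷ os) = play σ (h ∷ʳ (o , σ h o)) os

triple : {n : ℕ} → Fin n → Fin n → Fin n → Subset n
triple a b c = ⁅ a ⁆ ∪ (⁅ b ⁆ ∪ ⁅ c ⁆)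

edges : {n : ℕ} → List (Move n) → List (Subset n)
edges [] = []
edges ((((a , b) , _) , nothing) ∷ ms) = edges ms
edges ((((a , b) , _) , just (c , _)) ∷ ms) = triple a b c ∷ edges ms

Hyp : {n : ℕ} → Strategy n → List (Offer n) → List (Subset n)
Hyp σ os = edges (play σ [] os)

-- Loose-cycle hyperedges along the ordering v1 v2 ... vk (k even):
-- {v1,v2,v3}, {v3,v4,v5}, ..., {v_{k-1}, v_k, v1}.
cycleGo : {n : ℕ} → Fin n → List (Fin n) → List (Subset n)
cycleGo f (a ∷ b ∷ c ∷ rest) = triple a b c ∷ cycleGo f (c ∷ rest)
cycleGo f (a ∷ b ∷ []) = triple a b f ∷ []
cycleGo f _ = []

cycleEdges : {n : ℕ} → List (Fin n) → List (Subset n)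
cycleEdges [] = []
cycleEdges (v ∷ vs) = cycleGo v (v ∷ vs)

HasLooseHC : {n : ℕ} → List (Subset n) → Set
HasLooseHC {n} H =
  ∃[ vs ] (vs ↭ Data.List.allFin n) × All (λ e → e ∈ H) (cycleEdges vs)

-- A loose path x₀ m₁ x₁ … m_k x_k on linearly many vertices is built greedily.  Then every offer {x_i, f}
-- with f not among the links x_j is answered by x_{i-1}, so that f becomes an alternative filler of the
-- gadget {x_{i-1}, · , x_i}.  A union bound over pairs of linear-size sets shows that gadgets and fillers
-- get well mixed; up to a small set of poor fillers, small sets of fillers then expand, and alternating
-- paths exchange any free filler for one of linearly many others.  Hence, as long as at least two good
-- vertices are free, a random offer can be freed completely with probability bounded below.
--
-- While many vertices are still free, the free poor vertices are absorbed: w receives colours, edges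
-- {t, f, w} with t, f free, and an offer {t, b} answered by the head h of the path prolongs it by
-- w f t b h.  With κ poor vertices left, about √(n/κ) colours for each of them balance the cost of
-- colouring and linking, and ∑ √(n/κ) = O(n).  Afterwards freeable offers {a, b}, answered by the head,
-- prolong the path until three vertices are free.  Then linearly many edges {t, f, h} are collected, and
-- an offer {t, b} answered by x_k closes the cycle.
--
-- Except for the union bound, every stage spends a budget that decreases at constant expected speed
-- in steps of size O(√n); an exponential potential bounds the failure probability by O(1/√n).
module Submission where

open import Defs
open import Data.Nat using (ℕ; zero; suc; _+_; _*_; _∸_; _^_; _≤_; _<_; z≤n; s≤s; _≤?_; _<?_; >-nonZero)
open import Data.Nat.Properties
open import Data.Nat.DivMod using (_/_; _%_; m/n*n≤m; m≡m%n+[m/n]*n; m%n<n; m≥n⇒m/n>0)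
open import Data.Nat.Divisibility using (_∣_; _∣?_; divides; m∣m*n)
open import Data.Nat.Combinatorics using (_C_; nC1≡n; nCk+nC[k+1]≡[n+1]C[k+1])
open import Data.Nat.Tactic.RingSolver using (solve)
open import Data.List using () renaming (_∷_ to infixr 5 _∙_; [] to ε)
import Data.Bool.Properties as Bool
open import Data.Fin using (Fin; zero; suc; inject₁)
import Data.Fin as Fin
import Data.Fin.Properties as Fin
open import Data.Fin.Subset using (Subset; ⁅_⁆; _∪_)
open import Data.Fin.Subset.Properties using (∪-comm; ∪-assoc)
open import Data.Product using (Σ; Σ-syntax; _×_; _,_; proj₁; proj₂; ∃-syntax)
open import Data.Product.Properties using (≡-dec)
open import Data.Sum using (_⊎_; inj₁; inj₂; [_,_]′)
open import Data.Maybe using (Maybe; just; nothing)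
open import Data.Empty using (⊥; ⊥-elim)
open import Data.List using (List; []; _∷_; _∷ʳ_; _++_; [_]; length; map; concatMap; filter; allFin; cartesianProduct)
open import Data.List.Properties using (length-map; length-++; length-tabulate; ++-assoc; ++-identityʳ; map-++; filter-all; length-filter)
open import Data.List.Membership.Propositional using (_∈_; _∉_; find; lose)
open import Data.List.Membership.Propositional.Properties using (∈-map⁺; ∈-map⁻; ∈-++⁺ˡ; ∈-++⁺ʳ; ∈-++⁻; ∈-filter⁺; ∈-filter⁻; ∈-allFin; ∈-concatMap⁺; ∈-concatMap⁻; ∈-cartesianProduct⁺; ∈-cartesianProduct⁻; ∈-∃++)
open import Data.List.Relation.Unary.All as All using (All; []; _∷_)
import Data.List.Relation.Unary.All.Properties as All
open import Data.List.Relation.Unary.Any as Any using (Any; here; there; any?)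
open import Data.List.Relation.Unary.AllPairs using (AllPairs; []; _∷_)
open import Data.List.Relation.Unary.Unique.Propositional using (Unique)
import Data.List.Relation.Unary.Unique.Propositional.Properties as Unique
open import Data.List.Relation.Binary.Permutation.Propositional using (_↭_; ↭-refl; ↭-sym; ↭-trans; ↭-reflexive; prep; swap)
open import Data.List.Relation.Binary.Permutation.Propositional.Properties using (↭-length; shift; ++⁺; ++⁺ˡ; ++⁺ʳ; All-resp-↭; ∈-resp-↭; map⁺; shifts; drop-∷; ++-commutativeMonoid)
open import Data.Vec using (Vec; []; _∷_; toList; lookup; _[_]≔_)
import Data.Vec.Properties as Vec
import Algebra.Solver.CommutativeMonoid as CommutativeMonoidSolver
open import Function using (_∘_; id; case_of_)
open import Relation.Nullary using (¬_; Dec; yes; no; ¬?; _×-dec_; _⊎-dec_)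
open import Relation.Unary using (Decidable)
open import Relation.Binary.Definitions using (tri<; tri≈; tri>)
open import Relation.Binary.PropositionalEquality using (_≡_; _≢_; refl; sym; trans; cong; cong₂; subst; subst₂; module ≡-Reasoning)

-- A prescribed vertex is offered with probability only O(1/n), so a vertex that has to be placed
-- individually must be an answer. Most vertices avoid this by being interchangeable: an exchange of
-- fillers rearranges edges already present and spends no round, so instead of waiting for one pair
-- of free vertices the player waits for any of quadratically many freeable pairs.
--
-- Mixing controls only sets of at least g elements. Below that size expansion may fail; the poor
-- fillers form a set of maximal deficiency in the sense of Hall, and exchanges alter only gadgets
-- that no poor filler fits. Poor vertices therefore cannot be exchanged and have to be placed one
-- by one.
--
-- With κ of them left and c colours on each, a link takes about n/(κc) rounds and writes off the c
-- colours of one vertex; the two costs are equal at c = √(n/κ).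
--
-- Since n is even, the number of free vertices before the final stages is odd, and three is the
-- number needed to close the cycle.
--
-- All sets of linear size are measured by g, about n/100. The constant ω = 80000 is chosen so that
-- 2n² ≤ ωg² already when n ≤ 200g.

-- A certificate for linear arithmetic: `l ≤ r` is usually a sum of scaled hypotheses and `s` the
-- slack, so that only one identity remains for the ring solver.
lin : ∀ s {a b l r} → l ≤ r → a + r + s ≡ b + l → a ≤ b
lin s {a} {b} {l} {r} l≤r eq = ≤-trans (m≤m+n a s) (+-cancelʳ-≤ r (a + s) b (begin
  a + s + r  ≡⟨ solve (a ∙ s ∙ r ∙ ε) ⟩
  a + r + s  ≡⟨ eq ⟩
  b + l      ≤⟨ +-monoʳ-≤ b l≤r ⟩
  b + r      ∎))
  where open ≤-Reasoning

-- Sums over lists and counting of duplicate-free lists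

∑ : {A : Set} → List A → (A → ℕ) → ℕ
∑ []       f = 0
∑ (x ∷ xs) f = f x + ∑ xs f

∑-mono : {A : Set} (xs : List A) {f g : A → ℕ} → (∀ x → f x ≤ g x) → ∑ xs f ≤ ∑ xs g
∑-mono []       f≤g = z≤n
∑-mono (x ∷ xs) f≤g = +-mono-≤ (f≤g x) (∑-mono xs f≤g)

∑-cong : {A : Set} (xs : List A) {f g : A → ℕ} → (∀ x → f x ≡ g x) → ∑ xs f ≡ ∑ xs g
∑-cong []       f≡g = refl
∑-cong (x ∷ xs) f≡g = cong₂ _+_ (f≡g x) (∑-cong xs f≡g)

∑-+ : {A : Set} (xs : List A) (f g : A → ℕ) → ∑ xs (λ x → f x + g x) ≡ ∑ xs f + ∑ xs g
∑-+ []       f g = refl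
∑-+ (x ∷ xs) f g = trans (cong (f x + g x +_) (∑-+ xs f g)) (lem (f x) (g x) (∑ xs f) (∑ xs g))
  where
  lem : ∀ a b c d → a + b + (c + d) ≡ a + c + (b + d)
  lem a b c d = solve (a ∙ b ∙ c ∙ d ∙ ε)

∑-*ˡ : {A : Set} (xs : List A) (c : ℕ) (f : A → ℕ) → ∑ xs (λ x → c * f x) ≡ c * ∑ xs f
∑-*ˡ []       c f = sym (*-zeroʳ c)
∑-*ˡ (x ∷ xs) c f = trans (cong (c * f x +_) (∑-*ˡ xs c f)) (sym (*-distribˡ-+ c (f x) _))

∑-const : {A : Set} (xs : List A) (c : ℕ) → ∑ xs (λ _ → c) ≡ length xs * c
∑-const []       c = refl
∑-const (x ∷ xs) c = cong (c +_) (∑-const xs c)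

∑-swap : {A B : Set} (xs : List A) (ys : List B) (f : A → B → ℕ) →
  ∑ xs (λ x → ∑ ys (f x)) ≡ ∑ ys (λ y → ∑ xs (λ x → f x y))
∑-swap []       ys f = sym (trans (∑-const ys 0) (*-zeroʳ (length ys)))
∑-swap (x ∷ xs) ys f = trans (cong (∑ ys (f x) +_) (∑-swap xs ys f)) (sym (∑-+ ys (f x) _))

length-concatMap : {A B : Set} (f : A → List B) (xs : List A) →
  length (concatMap f xs) ≡ ∑ xs (λ x → length (f x))
length-concatMap f []       = refl
length-concatMap f (x ∷ xs) =
  trans (length-++ (f x)) (cong (length (f x) +_) (length-concatMap f xs))

[_]ᵈ : {P : Set} → Dec P → ℕ
[ yes _ ]ᵈ = 1
[ no _ ]ᵈ  = 0

∑-filter : {A : Set} {P : A → Set} (P? : Decidable P) (xs : List A) →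
  length (filter P? xs) ≡ ∑ xs (λ x → [ P? x ]ᵈ)
∑-filter P? [] = refl
∑-filter P? (x ∷ xs) with P? x
... | yes _ = cong suc (∑-filter P? xs)
... | no  _ = ∑-filter P? xs

unique-length-≤ : {A : Set} {xs ys : List A} → Unique xs → (∀ {x} → x ∈ xs → x ∈ ys) →
  length xs ≤ length ys
unique-length-≤ {xs = []} _ _ = z≤n
unique-length-≤ {xs = x ∷ xs} (x∉ ∷ u) xs⊆ with ∈-∃++ (xs⊆ (here refl))
... | as , bs , refl = subst (suc (length xs) ≤_) (sym (↭-length (shift x as bs)))
  (s≤s (unique-length-≤ u λ {y} y∈ → case ∈-resp-↭ (shift x as bs) (xs⊆ (there y∈)) of λ where
    (here refl) → ⊥-elim (All.lookup x∉ y∈ refl)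
    (there p)   → p))

unique-concatMap : {A B : Set} {f : A → List B} {xs : List A} → Unique xs → (∀ {x} → x ∈ xs → Unique (f x)) →
  (∀ {x y z} → z ∈ f x → z ∈ f y → x ≡ y) → Unique (concatMap f xs)
unique-concatMap {xs = []} _ _ _ = []
unique-concatMap {f = f} {xs = x ∷ xs} (x∉ ∷ u) uf inj =
  Unique.++⁺ (uf (here refl)) (unique-concatMap u (uf ∘ there) inj)
    λ { (z∈fx , z∈) → case find (∈-concatMap⁻ f {xs = xs} z∈) of λ where
      (y , y∈ , z∈fy) → All.lookup x∉ y∈ (inj z∈fx z∈fy) }

-- Offers

liftOffer : ∀ {n} → Offer n → Offer (suc n)
liftOffer ((a , b) , a<b) = (suc a , suc b) , s≤s a<b

offers : ∀ n → List (Offer n)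
offers zero    = []
offers (suc n) = map (λ j → (zero , suc j) , s≤s z≤n) (allFin n) ++ map liftOffer (offers n)

length-offers : ∀ n → length (offers n) ≡ n C 2
length-offers zero    = refl
length-offers (suc n) = begin
  length (offers (suc n))
    ≡⟨ length-++ (map (λ j → (zero , suc j) , s≤s z≤n) (allFin n)) ⟩
  length (map (λ j → (zero , suc j) , s≤s z≤n) (allFin n)) + length (map liftOffer (offers n))
    ≡⟨ cong₂ _+_ (trans (length-map _ (allFin n)) (length-tabulate {n = n} id))
                 (trans (length-map liftOffer (offers n)) (length-offers n)) ⟩
  n + n C 2       ≡⟨ cong (_+ n C 2) (sym (nC1≡n n)) ⟩
  n C 1 + n C 2   ≡⟨ nCk+nC[k+1]≡[n+1]C[k+1] n 1 ⟩
  suc n C 2       ∎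
  where open ≡-Reasoning

2*length-offers≤n² : ∀ n → 2 * length (offers n) ≤ n * n
2*length-offers≤n² zero    = z≤n
2*length-offers≤n² (suc n) = begin
  2 * length (offers (suc n))
    ≡⟨ cong (2 *_) (trans (length-++ (map (λ j → (zero , suc j) , s≤s z≤n) (allFin n)))
        (cong₂ _+_ (trans (length-map _ (allFin n)) (length-tabulate {n = n} id)) (length-map liftOffer (offers n)))) ⟩
  2 * (n + length (offers n))      ≡⟨ *-distribˡ-+ 2 n _ ⟩
  2 * n + 2 * length (offers n)    ≤⟨ +-monoʳ-≤ (2 * n) (2*length-offers≤n² n) ⟩
  2 * n + n * n                    ≤⟨ n≤1+n _ ⟩
  suc (2 * n + n * n)              ≡⟨ lem n ⟩
  suc n * suc n                    ∎
  where
  open ≤-Reasoning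
  lem : ∀ m → 1 + (2 * m + m * m) ≡ (1 + m) * (1 + m)
  lem m = solve (m ∙ ε)

offer-≡ : ∀ {n} {o o′ : Offer n} → proj₁ o ≡ proj₁ o′ → o ≡ o′
offer-≡ {o = _ , p} {_ , q} refl = cong (_ ,_) (≤-irrelevant p q)

∈-offers : ∀ {n} (o : Offer n) → o ∈ offers n
∈-offers {suc n} ((zero , suc b) , a<b) = ∈-++⁺ˡ
  (subst (_∈ map (λ j → (zero , suc j) , s≤s z≤n) (allFin n)) (offer-≡ refl) (∈-map⁺ _ (∈-allFin b)))
∈-offers {suc n} ((suc a , suc b) , s≤s a<b) =
  ∈-++⁺ʳ (map (λ j → (zero , suc j) , s≤s z≤n) (allFin n)) (∈-map⁺ liftOffer (∈-offers ((a , b) , a<b)))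

unique-offers : ∀ n → Unique (offers n)
unique-offers zero    = []
unique-offers (suc n) = Unique.++⁺
  (Unique.map⁺ (λ { refl → refl }) (Unique.allFin⁺ n))
  (Unique.map⁺ (λ { {_ , p} {_ , q} eq → offer-≡ (lem eq) }) (unique-offers n))
  λ { (p , q) → disj p q }
  where
  lem : ∀ {o o′ : Offer n} → liftOffer o ≡ liftOffer o′ → proj₁ o ≡ proj₁ o′
  lem refl = refl
  disj : ∀ {o} → o ∈ map (λ j → (zero , suc j) , s≤s z≤n) (allFin n) → o ∈ map liftOffer (offers n) → ⊥
  disj p q with ∈-map⁻ _ p | ∈-map⁻ liftOffer q
  ... | _ , _ , refl | _ , _ , ()

Hits : ∀ {n} → List (Fin n × Fin n) → Offer n → Set
Hits ps ((a , b) , _) = ((a , b) ∈ ps) ⊎ ((b , a) ∈ ps)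

_∈ₚ?_ : ∀ {n} (p : Fin n × Fin n) ps → Dec (p ∈ ps)
p ∈ₚ? ps = any? (≡-dec Fin._≟_ Fin._≟_ p) ps

hits? : ∀ {n} (ps : List (Fin n × Fin n)) → Decidable (Hits ps)
hits? ps ((a , b) , _) = ((a , b) ∈ₚ? ps) ⊎-dec ((b , a) ∈ₚ? ps)

-- Pairs are ordered and offers are not, so one offer accounts for at most two pairs.
hits-count : ∀ {n} {ps : List (Fin n × Fin n)} → Unique ps → All (λ p → proj₁ p ≢ proj₂ p) ps →
  length ps ≤ 2 * ∑ (offers n) (λ o → [ hits? ps o ]ᵈ)
hits-count {n} {ps} u ≢s = begin
  length ps ≤⟨ unique-length-≤ u (λ {p} p∈ → ∈-concatMap⁺ f (find-offer p p∈)) ⟩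
  length (concatMap f (offers n)) ≡⟨ length-concatMap f (offers n) ⟩
  ∑ (offers n) (λ o → length (f o)) ≤⟨ ∑-mono (offers n) bound ⟩
  ∑ (offers n) (λ o → 2 * [ hits? ps o ]ᵈ) ≡⟨ ∑-*ˡ (offers n) 2 _ ⟩
  2 * ∑ (offers n) (λ o → [ hits? ps o ]ᵈ) ∎
  where
  open ≤-Reasoning
  f : Offer n → List (Fin n × Fin n)
  f o@((a , b) , _) with hits? ps o
  ... | yes _ = (a , b) ∷ (b , a) ∷ []
  ... | no _  = []
  bound : ∀ o → length (f o) ≤ 2 * [ hits? ps o ]ᵈ
  bound o with hits? ps o
  ... | yes _ = ≤-refl
  ... | no _  = ≤-refl
  in-f : ∀ {a b} a<b → Hits ps ((a , b) , a<b) → ∀ {p} → p ∈ (a , b) ∷ (b , a) ∷ [] → p ∈ f ((a , b) , a<b)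
  in-f {a} {b} a<b h p∈ with hits? ps ((a , b) , a<b)
  ... | yes _ = p∈
  ... | no ¬h = ⊥-elim (¬h h)
  find-offer : ∀ p → p ∈ ps → Any (λ o → p ∈ f o) (offers n)
  find-offer (a , b) p∈ with Fin.<-cmp a b
  ... | tri< a<b _ _ = lose (∈-offers ((a , b) , a<b)) (in-f a<b (inj₁ p∈) (here refl))
  ... | tri≈ _ a≡b _ = ⊥-elim (All.lookup ≢s p∈ a≡b)
  ... | tri> _ _ b<a = lose (∈-offers ((b , a) , b<a)) (in-f b<a (inj₂ p∈) (there (here refl)))

-- Strategy trees

Edges : ℕ → Set
Edges n = List (Subset n)

extend : ∀ {n} → Edges n → (o : Offer n) → Maybe (Choice o) → Edges n
extend E _             nothing        = E
extend E ((a , b) , _) (just (c , _)) = triple a b c ∷ E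

-- A T-round strategy tree started from the hypergraph E; every leaf either certifies P or is a failure.
Play : ∀ {n} → (Edges n → Set) → ℕ → Edges n → Set
Play P zero    E = Maybe (P E)
Play P (suc T) E = ∀ o → Σ[ c ∈ Maybe (Choice o) ] Play P T (extend E o c)

module _ {n : ℕ} where

  Nₒ : ℕ
  Nₒ = length (offers n)

  bad : ∀ {P : Edges n → Set} T {E} → Play P T E → ℕ
  bad zero    (just _) = 0
  bad zero    nothing  = 1
  bad (suc T) t        = ∑ (offers n) λ o → bad T (proj₂ (t o))

  good : ∀ {P : Edges n → Set} T {E} → Play P T E → List (Vec (Offer n) T)
  good zero    (just _) = [ [] ]
  good zero    nothing  = []
  good (suc T) t        = concatMap (λ o → map (o ∷_) (good T (proj₂ (t o)))) (offers n)

  good+bad : ∀ {P : Edges n → Set} T {E} (t : Play P T E) → length (good T t) + bad T t ≡ Nₒ ^ T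
  good+bad zero    (just _) = refl
  good+bad zero    nothing  = refl
  good+bad (suc T) t        = begin
    length (good (suc T) t) + bad (suc T) t
      ≡⟨ cong (_+ bad (suc T) t) (trans (length-concatMap _ (offers n))
          (∑-cong (offers n) λ o → length-map (o ∷_) (good T (proj₂ (t o))))) ⟩
    ∑ (offers n) (λ o → length (good T (proj₂ (t o)))) + bad (suc T) t
      ≡⟨ sym (∑-+ (offers n) _ _) ⟩
    ∑ (offers n) (λ o → length (good T (proj₂ (t o))) + bad T (proj₂ (t o)))
      ≡⟨ ∑-cong (offers n) (λ o → good+bad T (proj₂ (t o))) ⟩
    ∑ (offers n) (λ _ → Nₒ ^ T)
      ≡⟨ ∑-const (offers n) _ ⟩
    Nₒ ^ suc T ∎
    where open ≡-Reasoning

  unique-good : ∀ {P : Edges n → Set} T {E} (t : Play P T E) → Unique (good T t)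
  unique-good zero    (just _) = [] ∷ []
  unique-good zero    nothing  = []
  unique-good (suc T) t        = unique-concatMap (unique-offers n)
    (λ {o} _ → Unique.map⁺ (λ { refl → refl }) (unique-good T (proj₂ (t o))))
    λ p q → case ∈-map⁻ _ p of λ { (_ , _ , refl) → case ∈-map⁻ _ q of λ { (_ , _ , refl) → refl } }

  result : ∀ {P : Edges n → Set} T {E} → Play P T E → Vec (Offer n) T → Edges n
  result zero    {E} t []       = E
  result (suc T)     t (o ∷ os) = result T (proj₂ (t o)) os

  good-result : ∀ {P : Edges n → Set} T {E} (t : Play P T E) {os} → os ∈ good T t → P (result T t os)
  good-result zero    (just p) (here refl) = p
  good-result (suc T) t        os∈ with find (∈-concatMap⁻ _ {xs = offers n} os∈)
  ... | o , _ , os∈′ with ∈-map⁻ (o ∷_) os∈′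
  ...   | os′ , os′∈ , refl = good-result T (proj₂ (t o)) os′∈

  -- The recorded answers are skipped: the offers alone determine the position in the tree.
  strategy : ∀ {P : Edges n → Set} T {E} → Play P T E → Strategy n
  strategy zero    t h             o = nothing
  strategy (suc T) t []            o = proj₁ (t o)
  strategy (suc T) t ((o′ , _) ∷ h) o = strategy T (proj₂ (t o′)) h o

  edges-++ˡ : ∀ (h h′ : List (Move n)) {e} → e ∈ edges h → e ∈ edges (h ++ h′)
  edges-++ˡ ((_ , nothing) ∷ h) h′ e∈        = edges-++ˡ h h′ e∈
  edges-++ˡ ((_ , just _) ∷ h)  h′ (here eq)  = here eq
  edges-++ˡ ((_ , just _) ∷ h)  h′ (there e∈) = there (edges-++ˡ h h′ e∈)

  edges-++ʳ : ∀ (h h′ : List (Move n)) {e} → e ∈ edges h′ → e ∈ edges (h ++ h′)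
  edges-++ʳ []                  h′ e∈ = e∈
  edges-++ʳ ((_ , nothing) ∷ h) h′ e∈ = edges-++ʳ h h′ e∈
  edges-++ʳ ((_ , just _) ∷ h)  h′ e∈ = there (edges-++ʳ h h′ e∈)

  edges-play : ∀ (σ : Strategy n) h os {e} → e ∈ edges h → e ∈ edges (play σ h os)
  edges-play σ h []       e∈ = e∈
  edges-play σ h (o ∷ os) e∈ = edges-play σ _ os (edges-++ˡ h _ e∈)

  extend⁻ : ∀ E (o : Offer n) c {e} → e ∈ extend E o c → (e ∈ E) ⊎ (e ∈ edges [ (o , c) ])
  extend⁻ E o nothing  e∈         = inj₁ e∈
  extend⁻ E o (just _) (here eq)  = inj₂ (here eq)
  extend⁻ E o (just _) (there e∈) = inj₁ e∈

  -- Tree and play list their edges in different orders, so they are compared by inclusion only;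
  -- this suffices because a loose Hamilton cycle survives additional edges. The hypothesis on `σ`
  -- says that after the history `h` it continues as the subtree `t` prescribes.
  result⊆play : ∀ {P : Edges n → Set} T {E} (t : Play P T E) os (σ : Strategy n) h →
    (∀ h′ o → σ (h ++ h′) o ≡ strategy T t h′ o) →
    ∀ {e} → e ∈ result T t os → (e ∈ E) ⊎ (e ∈ edges (play σ h (toList os)))
  result⊆play zero    t []       σ h eq e∈ = inj₁ e∈
  result⊆play (suc T) {E} t (o ∷ os) σ h eq {e} e∈ = body (σ h o) σho
    where
    σho : σ h o ≡ proj₁ (t o)
    σho = trans (cong (λ x → σ x o) (sym (++-identityʳ h))) (eq [] o)
    -- `σ h o` is abstracted to `c`, as the equation `σho` itself cannot be matched with `refl`.
    body : ∀ c → c ≡ proj₁ (t o) → (e ∈ E) ⊎ (e ∈ edges (play σ (h ∷ʳ (o , c)) (toList os)))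
    body c refl with result⊆play T (proj₂ (t o)) os σ (h ∷ʳ (o , c))
        (λ h′ o′ → trans (cong (λ x → σ x o′) (++-assoc h [ (o , c) ] h′)) (eq ((o , c) ∷ h′) o′)) e∈
    ... | inj₂ e∈play = inj₂ e∈play
    ... | inj₁ e∈E′  with extend⁻ E o c e∈E′
    ...   | inj₁ e∈E  = inj₁ e∈E
    ...   | inj₂ e∈h  = inj₂ (edges-play σ _ (toList os) (edges-++ʳ h _ e∈h))

  -- The proportion of failing offer sequences is at most q / n.
  record Wins (P : Edges n → Set) (T : ℕ) (E : Edges n) (q : ℕ) : Set where
    constructor wins
    field
      tree    : Play P T E
      bad-few : bad T tree * n ≤ q * Nₒ ^ T

  open Wins public

  idle : ∀ {P : Edges n → Set} T {E} → P E → Play P T E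
  idle zero    p = just p
  idle (suc T) p = λ o → nothing , idle T p

  bad-idle : ∀ {P : Edges n → Set} T {E} (p : P E) → bad {P} T (idle T p) ≡ 0
  bad-idle         zero    p = refl
  bad-idle {P = P} (suc T) p = trans (∑-cong (offers n) (λ o → bad-idle {P} T p))
    (trans (∑-const (offers n) 0) (*-zeroʳ Nₒ))

  lost : ∀ {P : Edges n → Set} T {E} → Play P T E
  lost zero    = nothing
  lost (suc T) = λ o → nothing , lost T

  bad≤ : ∀ {P : Edges n → Set} T {E} (t : Play P T E) → bad T t ≤ Nₒ ^ T
  bad≤ T t = subst (bad T t ≤_) (good+bad T t) (m≤n+m _ _)

  _>>=_ : ∀ {P Q : Edges n → Set} {T U E} → Play P T E → (∀ {E} → P E → Play Q U E) → Play Q (T + U) E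
  _>>=_ {T = zero}  (just p) f = f p
  _>>=_ {T = zero}  nothing  f = lost _
  _>>=_ {T = suc T} t        f = λ o → proj₁ (t o) , proj₂ (t o) >>= f

  bad->>= : ∀ {P Q : Edges n → Set} T U {E} (t : Play P T E) (f : ∀ {E} → P E → Play Q U E) q →
    (∀ {E} (p : P E) → bad U (f p) * n ≤ q * Nₒ ^ U) →
    bad (T + U) (t >>= f) * n ≤ bad T t * n * Nₒ ^ U + Nₒ ^ T * (q * Nₒ ^ U)
  bad->>= zero U (just p) f q fq = ≤-trans (fq p) (≤-reflexive (sym (+-identityʳ _)))
  bad->>= {Q = Q} zero U {E} nothing f q fq = begin
    bad U (lost {Q} U {E}) * n ≤⟨ *-monoˡ-≤ n (bad≤ U (lost {Q} U {E})) ⟩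
    Nₒ ^ U * n                 ≡⟨ *-comm (Nₒ ^ U) n ⟩
    n * Nₒ ^ U                 ≡⟨ cong (_* Nₒ ^ U) (sym (*-identityˡ n)) ⟩
    1 * n * Nₒ ^ U             ≤⟨ m≤m+n _ _ ⟩
    1 * n * Nₒ ^ U + 1 * (q * Nₒ ^ U) ∎
    where open ≤-Reasoning
  bad->>= (suc T) U t f q fq = begin
    ∑ (offers n) (λ o → bad (T + U) (proj₂ (t o) >>= f)) * n
      ≡⟨ trans (*-comm _ n) (sym (∑-*ˡ (offers n) n _)) ⟩
    ∑ (offers n) (λ o → n * bad (T + U) (proj₂ (t o) >>= f))
      ≤⟨ ∑-mono (offers n) (λ o → ≤-trans (≤-reflexive (*-comm n _)) (bad->>= T U (proj₂ (t o)) f q fq)) ⟩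
    ∑ (offers n) (λ o → bad T (proj₂ (t o)) * n * Nₒ ^ U + Nₒ ^ T * (q * Nₒ ^ U))
      ≡⟨ ∑-+ (offers n) _ _ ⟩
    ∑ (offers n) (λ o → bad T (proj₂ (t o)) * n * Nₒ ^ U) + ∑ (offers n) (λ o → Nₒ ^ T * (q * Nₒ ^ U))
      ≡⟨ cong₂ _+_ (trans (∑-cong (offers n) (λ o → lem (bad T (proj₂ (t o))) (Nₒ ^ U)))
           (trans (∑-*ˡ (offers n) (n * Nₒ ^ U) _) (sym (lem (bad (suc T) t) (Nₒ ^ U)))))
         (trans (∑-const (offers n) _) (sym (*-assoc Nₒ (Nₒ ^ T) _))) ⟩
    bad (suc T) t * n * Nₒ ^ U + Nₒ ^ suc T * (q * Nₒ ^ U) ∎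
    where
    open ≤-Reasoning
    lem : ∀ b c → b * n * c ≡ n * c * b
    lem b c = solve (b ∙ n ∙ c ∙ ε)

  infixl 1 _then_

  -- Union bound: sequences that fail in the first tree are charged in full, all others at rate
  -- `r / n`.
  _then_ : ∀ {P Q : Edges n → Set} {T U E q r} → Wins P T E q → (∀ {E} → P E → Wins Q U E r) →
    Wins Q (T + U) E (q + r)
  _then_ {T = T} {U} {q = q} {r} (wins t tq) f = wins (t >>= (tree ∘ f)) (begin
    bad (T + U) (t >>= (tree ∘ f)) * n             ≤⟨ bad->>= T U t (tree ∘ f) r (bad-few ∘ f) ⟩
    bad T t * n * Nₒ ^ U + Nₒ ^ T * (r * Nₒ ^ U)   ≤⟨ +-monoˡ-≤ _ (*-monoˡ-≤ (Nₒ ^ U) tq) ⟩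
    q * Nₒ ^ T * Nₒ ^ U + Nₒ ^ T * (r * Nₒ ^ U)    ≡⟨ lem (Nₒ ^ T) (Nₒ ^ U) ⟩
    (q + r) * (Nₒ ^ T * Nₒ ^ U)                    ≡⟨ cong ((q + r) *_) (sym (^-distribˡ-+-* Nₒ T U)) ⟩
    (q + r) * Nₒ ^ (T + U) ∎)
    where
    open ≤-Reasoning
    lem : ∀ x y → q * x * y + x * (r * y) ≡ (q + r) * (x * y)
    lem x y = solve (q ∙ r ∙ x ∙ y ∙ ε)

  extend-⊆ : ∀ (E : Edges n) (o : Offer n) c {e} → e ∈ E → e ∈ extend E o c
  extend-⊆ E o nothing  e∈ = e∈
  extend-⊆ E o (just _) e∈ = there e∈

  module _ {P : Edges n → Set} {E₀ : Edges n} where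

    -- The hypergraph only grows, so every leaf still has the initial edges. Later stages rely on
    -- this when they use gadget edges of earlier ones.
    Keeping : Edges n → Set
    Keeping E = (∀ {e} → e ∈ E₀ → e ∈ E) × P E

    keep : ∀ T {E} → (∀ {e} → e ∈ E₀ → e ∈ E) → Play P T E → Play Keeping T E
    keep zero    old (just p) = just (old , p)
    keep zero    old nothing  = nothing
    keep (suc T) old t        = λ o → proj₁ (t o) , keep T (extend-⊆ _ o (proj₁ (t o)) ∘ old) (proj₂ (t o))

    bad-keep : ∀ T {E} (old : ∀ {e} → e ∈ E₀ → e ∈ E) (t : Play P T E) → bad T (keep T old t) ≡ bad T t
    bad-keep zero    old (just p) = refl
    bad-keep zero    old nothing  = refl
    bad-keep (suc T) old t        = ∑-cong (offers n) λ o → bad-keep T _ (proj₂ (t o))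

  keeping : ∀ {P : Edges n → Set} T {E q} → Wins P T E q → Wins (λ F → (∀ {e} → e ∈ E → e ∈ F) × P F) T E q
  keeping T {q = q} (wins t tq) = wins (keep T id t) (subst (λ b → b * n ≤ q * Nₒ ^ T) (sym (bad-keep T id t)) tq)

  -- Potential arguments

  module Potential (P S : Edges n → Set) (V : ∀ {E} → S E → ℕ) (d θ : ℕ)
    (step : ∀ {E} (s : S E) → P E ⊎
      ((θ ≤ V s) × (Σ[ f ∈ (∀ o → Σ[ c ∈ Maybe (Choice o) ] S (extend E o c)) ]
        (suc d * ∑ (offers n) (λ o → V (proj₂ (f o))) ≤ d * (Nₒ * V s))))) where

    run : ∀ T {E} → S E → Play P T E
    run T s with step s
    run T       s | inj₁ p           = idle T p
    run zero    s | inj₂ _           = nothing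
    run (suc T) s | inj₂ (_ , f , _) = λ o → proj₁ (f o) , run T (proj₂ (f o))

    -- Supermartingale and Markov's inequality: the mean of `V` shrinks by the factor `d / (d + 1)`
    -- per round, while `V` is at least `θ` at every unfinished leaf.
    bad-run : ∀ T {E} (s : S E) → θ * bad T (run T s) * suc d ^ T ≤ V s * (d ^ T * Nₒ ^ T)
    bad-run T s with step s
    bad-run T {E} s | inj₁ p = ≤-trans (≤-reflexive (cong (_* suc d ^ T)
      (trans (cong (θ *_) (bad-idle {P} T p)) (*-zeroʳ θ)))) z≤n
    bad-run zero s | inj₂ (θ≤V , _) = begin
      θ * 1 * 1  ≡⟨ trans (*-identityʳ _) (*-identityʳ θ) ⟩
      θ          ≤⟨ θ≤V ⟩
      V s        ≡⟨ sym (*-identityʳ (V s)) ⟩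
      V s * 1    ∎
      where open ≤-Reasoning
    bad-run (suc T) s | inj₂ (_ , f , V≤) = begin
      θ * ∑ (offers n) b * (suc d * D)
        ≡⟨ lem₁ (∑ (offers n) b) D ⟩
      suc d * (θ * D * ∑ (offers n) b)
        ≡⟨ cong (suc d *_) (sym (∑-*ˡ (offers n) (θ * D) b)) ⟩
      suc d * ∑ (offers n) (λ o → θ * D * b o)
        ≤⟨ *-monoʳ-≤ (suc d) (∑-mono (offers n) λ o → ≤-trans
             (≤-reflexive (lem₂ (b o) D)) (≤-trans (bad-run T (proj₂ (f o))) (≤-reflexive (*-comm _ X)))) ⟩
      suc d * ∑ (offers n) (λ o → X * V (proj₂ (f o)))
        ≡⟨ cong (suc d *_) (∑-*ˡ (offers n) X _) ⟩
      suc d * (X * ∑ (offers n) (λ o → V (proj₂ (f o))))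
        ≡⟨ lem₃ X _ ⟩
      X * (suc d * ∑ (offers n) (λ o → V (proj₂ (f o))))
        ≤⟨ *-monoʳ-≤ X V≤ ⟩
      X * (d * (Nₒ * V s))
        ≡⟨ lem₄ (d ^ T) (Nₒ ^ T) (V s) Nₒ ⟩
      V s * (d * d ^ T * (Nₒ * Nₒ ^ T)) ∎
      where
      open ≤-Reasoning
      b = λ o → bad T (run T (proj₂ (f o)))
      D = suc d ^ T
      X = d ^ T * Nₒ ^ T
      lem₁ : ∀ x y → θ * x * (suc d * y) ≡ suc d * (θ * y * x)
      lem₁ x y = solve (θ ∙ d ∙ x ∙ y ∙ ε)
      lem₂ : ∀ x y → θ * y * x ≡ θ * x * y
      lem₂ x y = solve (θ ∙ x ∙ y ∙ ε)
      lem₃ : ∀ x y → suc d * (x * y) ≡ x * (suc d * y)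
      lem₃ x y = solve (d ∙ x ∙ y ∙ ε)
      lem₄ : ∀ x y v m → x * y * (d * (m * v)) ≡ v * (d * x * (m * y))
      lem₄ x y v m = solve (d ∙ x ∙ y ∙ v ∙ m ∙ ε)

-- Symmetries of triples and inequalities for powers

triple-swap : ∀ {n} (a b c : Fin n) → triple a b c ≡ triple b a c
triple-swap a b c = trans (sym (∪-assoc ⁅ a ⁆ ⁅ b ⁆ ⁅ c ⁆))
  (trans (cong (_∪ ⁅ c ⁆) (∪-comm ⁅ a ⁆ ⁅ b ⁆)) (∪-assoc ⁅ b ⁆ ⁅ a ⁆ ⁅ c ⁆))

triple-rot : ∀ {n} (a b c : Fin n) → triple a b c ≡ triple b c a
triple-rot a b c = trans (∪-comm ⁅ a ⁆ (⁅ b ⁆ ∪ ⁅ c ⁆)) (∪-assoc ⁅ b ⁆ ⁅ c ⁆ ⁅ a ⁆)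

triple-rev : ∀ {n} (a b c : Fin n) → triple a b c ≡ triple c b a
triple-rev a b c = trans (triple-rot a b c) (triple-swap b c a)

^-positive : ∀ d T → 1 ≤ suc d ^ T
^-positive d T = ≤-trans (≤-reflexive (sym (^-zeroˡ T))) (^-monoˡ-≤ T {1} {suc d} (s≤s z≤n))

^-*-distrib : ∀ x y k → x ^ k * y ^ k ≡ (x * y) ^ k
^-*-distrib x y zero    = refl
^-*-distrib x y (suc k) = trans (lem (x ^ k) (y ^ k)) (cong (x * y *_) (^-*-distrib x y k))
  where
  lem : ∀ a b → x * a * (y * b) ≡ x * y * (a * b)
  lem a b = solve (x ∙ y ∙ a ∙ b ∙ ε)

bernoulli : ∀ d k → d ^ k * (d + k) ≤ d * suc d ^ k
bernoulli d zero    = ≤-reflexive (lem d)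
  where
  lem : ∀ x → 1 * (x + 0) ≡ x * 1
  lem x = solve (x ∙ ε)
bernoulli d (suc k) = begin
  d * d ^ k * (d + suc k)                 ≡⟨ lem (d ^ k) ⟩
  d * (d ^ k * (d + k)) + d * d ^ k       ≤⟨ +-monoʳ-≤ _ (*-monoʳ-≤ d (m≤m*n (d ^ k) 1)) ⟩
  d * (d ^ k * (d + k)) + d * (d ^ k * 1) ≤⟨ +-mono-≤ (*-monoʳ-≤ d (bernoulli d k))
                                               (*-monoʳ-≤ d (≤-trans (≤-reflexive (*-identityʳ _)) (^-monoˡ-≤ k (n≤1+n d)))) ⟩
  d * (d * suc d ^ k) + d * suc d ^ k     ≡⟨ lem′ (suc d ^ k) ⟩
  d * (suc d * suc d ^ k)                 ∎
  where
  open ≤-Reasoning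
  lem : ∀ x → d * x * (d + suc k) ≡ d * (x * (d + k)) + d * x
  lem x = solve (d ∙ k ∙ x ∙ ε)
  lem′ : ∀ x → d * (d * x) + d * x ≡ d * (suc d * x)
  lem′ x = solve (d ∙ x ∙ ε)

-- Spending a budget at constant expected speed

module _ {n : ℕ} where

  private
    N : ℕ
    N = length (offers n)

  -- By `enough`, gain times the probability of offering one of the pairs is at least 2, so the budget
  -- decreases at constant expected speed.
  record Progress (S : ℕ → Edges n → Set) (d W : ℕ) (E : Edges n) : Set where
    constructor progress
    field
      gain     : ℕ
      rest     : ℕ
      pairs    : List (Fin n × Fin n)
      gain≤    : gain ≤ suc d
      budget   : rest + gain ≤ W
      unique   : Unique pairs
      proper   : All (λ p → proj₁ p ≢ proj₂ p) pairs
      enough   : 2 * (n * n) ≤ length pairs * gain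
      respond  : ∀ {a b} → (a , b) ∈ pairs → Σ[ c ∈ Fin n ] ((c ≢ a) × (c ≢ b) × S rest (triple a b c ∷ E))

  module Drift (P : Edges n → Set) (S : ℕ → Edges n → Set) (d W₀ : ℕ)
    (step : ∀ {W E} → S W E → P E ⊎ Progress S d W E) where

    D : ℕ
    D = suc d

    -- The exponential potential `(1 + 1/D) ^ j`, multiplied by `D ^ W₀` to stay integral.
    v : ℕ → ℕ
    v j = suc D ^ j * D ^ (W₀ ∸ j)

    v-suc : ∀ {j} → suc j ≤ W₀ → v (suc j) * D ≡ v j * suc D
    v-suc {j} j<W₀ = begin
      suc D * suc D ^ j * D ^ (W₀ ∸ suc j) * D    ≡⟨ lem D (suc D ^ j) (D ^ (W₀ ∸ suc j)) ⟩
      suc D ^ j * (D * D ^ (W₀ ∸ suc j)) * suc D  ≡⟨ cong (λ k → suc D ^ j * D ^ k * suc D) (sym (∸-suc′ j<W₀)) ⟩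
      v j * suc D                                 ∎
      where
      open ≡-Reasoning
      lem : ∀ D x y → suc D * x * y * D ≡ x * (D * y) * suc D
      lem D x y = solve (D ∙ x ∙ y ∙ ε)
      ∸-suc′ : ∀ {m k} → suc m ≤ k → k ∸ m ≡ suc (k ∸ suc m)
      ∸-suc′ {zero}  (s≤s _)         = refl
      ∸-suc′ {suc m} (s≤s p) = ∸-suc′ p

    v-step : ∀ {j} → suc j ≤ W₀ → v j ≤ v (suc j)
    v-step {j} j<W₀ = *-cancelʳ-≤ (v j) (v (suc j)) D
      (≤-trans (*-monoʳ-≤ (v j) (n≤1+n D)) (≤-reflexive (sym (v-suc j<W₀))))

    v-+ : ∀ i w → i + w ≤ W₀ → v i ≤ v (i + w)
    v-+ i zero    _ = ≤-reflexive (cong v (sym (+-identityʳ i)))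
    v-+ i (suc w) p = ≤-trans (v-+ i w (≤-trans (n≤1+n _) p′))
        (≤-trans (v-step p′) (≤-reflexive (cong v (sym (+-suc i w)))))
      where
      p′ : suc (i + w) ≤ W₀
      p′ = subst (_≤ W₀) (+-suc i w) p

    v-mono : ∀ {i j} → i ≤ j → j ≤ W₀ → v i ≤ v j
    v-mono {i} i≤j j≤W₀ with m≤n⇒∃[o]m+o≡n i≤j
    ... | w , refl = v-+ i w j≤W₀

    -- Bernoulli's inequality: `(1 + 1/D) ^ w` is at least `1 + w/D`.
    v-gain : ∀ i w → i + w ≤ W₀ → v i * (D + w) ≤ v (i + w) * D
    v-gain i zero    _ = ≤-reflexive (cong₂ (λ x y → v x * y) (sym (+-identityʳ i)) (+-identityʳ D))
    v-gain i (suc w) p = begin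
      v i * (D + suc w)        ≡⟨ lem (v i) D w ⟩
      v i * (D + w) + v i      ≤⟨ +-mono-≤ (v-gain i w q) (v-+ i w q) ⟩
      v (i + w) * D + v (i + w) ≡⟨ trans (+-comm _ (v (i + w))) (sym (*-suc (v (i + w)) D)) ⟩
      v (i + w) * suc D        ≡⟨ sym (v-suc p′) ⟩
      v (suc (i + w)) * D      ≡⟨ cong (λ j → v j * D) (sym (+-suc i w)) ⟩
      v (i + suc w) * D        ∎
      where
      open ≤-Reasoning
      p′ : suc (i + w) ≤ W₀
      p′ = subst (_≤ W₀) (+-suc i w) p
      q : i + w ≤ W₀
      q = ≤-trans (n≤1+n _) p′
      lem : ∀ x D w → x * (D + suc w) ≡ x * (D + w) + x
      lem x D w = solve (x ∙ D ∙ w ∙ ε)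

    Budgeted : Edges n → Set
    Budgeted E = Σ[ W ∈ ℕ ] ((W ≤ W₀) × S W E)

    V : ∀ {E} → Budgeted E → ℕ
    V (W , _) = v W

    module _ {W E} (W≤ : W ≤ W₀) (s : S W E) (m : Progress S d W E) where
      open Progress m

      rest≤ : rest ≤ W
      rest≤ = ≤-trans (m≤m+n rest gain) budget

      next : ∀ o → Dec (Hits pairs o) → Σ[ c ∈ Maybe (Choice o) ] Budgeted (extend E o c)
      next o (no _) = nothing , W , W≤ , s
      next ((a , b) , _) (yes (inj₁ p)) with respond p
      ... | c , c≢a , c≢b , s′ = just (c , c≢a , c≢b) , rest , ≤-trans rest≤ W≤ , s′
      next ((a , b) , _) (yes (inj₂ p)) with respond p
      ... | c , c≢b , c≢a , s′ = just (c , c≢a , c≢b) , rest , ≤-trans rest≤ W≤ ,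
        subst (λ e → S rest (e ∷ E)) (triple-swap b a c) s′

      Δ : ℕ
      Δ = v W ∸ v rest

      split : v rest + Δ ≡ v W
      split = m+[n∸m]≡n (v-mono rest≤ W≤)

      V-next : ∀ o h → V (proj₂ (next o h)) + Δ * [ h ]ᵈ ≡ v W
      V-next o             (no _)         = trans (cong (v W +_) (*-zeroʳ Δ)) (+-identityʳ _)
      V-next ((a , b) , _) (yes (inj₁ p)) = trans (cong (v rest +_) (*-identityʳ Δ)) split
      V-next ((a , b) , _) (yes (inj₂ p)) = trans (cong (v rest +_) (*-identityʳ Δ)) split

      p : ℕ
      p = ∑ (offers n) λ o → [ hits? pairs o ]ᵈ

      -- By `v-gain` the drop `Δ` is at least `gain / D` times the lower value `v rest`; because
      -- `gain` is at most `D`, it is also at least `gain / (2 * D)` times the upper value `v W`.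
      gain*v≤ : gain * v W ≤ 2 * (D * Δ)
      gain*v≤ = begin
        gain * v W                  ≡⟨ cong (gain *_) (sym split) ⟩
        gain * (v rest + Δ)         ≡⟨ *-distribˡ-+ gain _ _ ⟩
        gain * v rest + gain * Δ    ≤⟨ +-mono-≤ g₁ (*-monoˡ-≤ Δ gain≤) ⟩
        D * Δ + D * Δ               ≡⟨ cong (D * Δ +_) (sym (+-identityʳ _)) ⟩
        2 * (D * Δ)                 ∎
        where
        open ≤-Reasoning
        lem : ∀ x D g → g * x + x * D ≡ x * (D + g)
        lem x D g = solve (x ∙ D ∙ g ∙ ε)
        lem′ : ∀ x y D → (x + y) * D ≡ D * y + x * D
        lem′ x y D = solve (x ∙ y ∙ D ∙ ε)
        g₁ : gain * v rest ≤ D * Δ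
        g₁ = +-cancelʳ-≤ (v rest * D) _ _ (begin
          gain * v rest + v rest * D  ≡⟨ lem (v rest) D gain ⟩
          v rest * (D + gain)         ≤⟨ v-gain rest gain (≤-trans budget W≤) ⟩
          v (rest + gain) * D         ≤⟨ *-monoˡ-≤ D (v-mono budget W≤) ⟩
          v W * D                     ≡⟨ cong (_* D) (sym split) ⟩
          (v rest + Δ) * D            ≡⟨ lem′ (v rest) Δ D ⟩
          D * Δ + v rest * D          ∎)

      -- An offer hits with probability `p / N`, so `enough` makes the expected drop at least
      -- `v W / D`, which is the decay that `Potential` asks for.
      N*v≤ : N * v W ≤ D * (p * Δ)
      N*v≤ = *-cancelˡ-≤ 4 (begin
        4 * (N * v W)                ≡⟨ lem₁ N (v W) ⟩
        2 * (2 * N) * v W            ≤⟨ *-monoˡ-≤ (v W) (*-monoʳ-≤ 2 (2*length-offers≤n² n)) ⟩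
        2 * (n * n) * v W             ≤⟨ *-monoˡ-≤ (v W) enough ⟩
        length pairs * gain * v W     ≡⟨ *-assoc (length pairs) gain _ ⟩
        length pairs * (gain * v W)   ≤⟨ *-mono-≤ (hits-count unique proper) gain*v≤ ⟩
        2 * p * (2 * (D * Δ))         ≡⟨ lem₂ p D Δ ⟩
        4 * (D * (p * Δ))             ∎)
        where
        open ≤-Reasoning
        lem₁ : ∀ x y → 4 * (x * y) ≡ 2 * (2 * x) * y
        lem₁ x y = solve (x ∙ y ∙ ε)
        lem₂ : ∀ x y z → 2 * x * (2 * (y * z)) ≡ 4 * (y * (x * z))
        lem₂ x y z = solve (x ∙ y ∙ z ∙ ε)

      V≤ : suc d * ∑ (offers n) (λ o → V (proj₂ (next o (hits? pairs o)))) ≤ d * (N * v W)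
      V≤ = +-cancelʳ-≤ (N * v W) _ _ (begin
        D * ∑V + N * v W         ≤⟨ +-monoʳ-≤ (D * ∑V) N*v≤ ⟩
        D * ∑V + D * (p * Δ)      ≡⟨ sym (*-distribˡ-+ D ∑V (p * Δ)) ⟩
        D * (∑V + p * Δ)          ≡⟨ cong (D *_) total ⟩
        D * (N * v W)            ≡⟨ +-comm (N * v W) _ ⟩
        d * (N * v W) + N * v W ∎)
        where
        open ≤-Reasoning
        ∑V = ∑ (offers n) (λ o → V (proj₂ (next o (hits? pairs o))))
        total : ∑V + p * Δ ≡ N * v W
        total = trans (cong (∑V +_) (trans (*-comm p Δ) (sym (∑-*ˡ (offers n) Δ _))))
          (trans (sym (∑-+ (offers n) _ _))
            (trans (∑-cong (offers n) (λ o → V-next o (hits? pairs o))) (∑-const (offers n) _)))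

    step′ : ∀ {E} (s : Budgeted E) → P E ⊎ ((D ^ W₀ ≤ V s) ×
      (Σ[ f ∈ (∀ o → Σ[ c ∈ Maybe (Choice o) ] Budgeted (extend E o c)) ]
        (suc d * ∑ (offers n) (λ o → V (proj₂ (f o))) ≤ d * (N * V s))))
    step′ (W , W≤ , s) with step s
    ... | inj₁ p = inj₁ p
    ... | inj₂ m = inj₂ (≤-trans (≤-reflexive (sym (+-identityʳ _))) (v-mono z≤n W≤) ,
      (λ o → next W≤ s m o (hits? (Progress.pairs m) o)) , V≤ W≤ s m)

  -- With `D = d + 2`, the potential starts at `(1 + 1/D) ^ W₀` and loses a factor `1 - 1/D` per
  -- round. After `W₀ + n` rounds the bound is `((D + 1) * (D - 1) / D²) ^ W₀` times
  -- `(1 - 1/D) ^ n`; the first factor is at most 1, and by `bernoulli` the second is at most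
  -- `(d + 1) / n`.
  drift : ∀ {P : Edges n → Set} {S : ℕ → Edges n → Set} {d W₀ E} →
    (∀ {W E} → S W E → P E ⊎ Progress S (suc d) W E) → S W₀ E → Wins P (W₀ + n) E (suc d)
  drift {P} {S} {d′} {W₀} {E} step s = wins (run (W₀ + n) s₀) (*-cancelʳ-≤ _ _ (d ^ n) {{>-nonZero (^-positive d′ n)}} (begin
      b * n * d ^ n                ≤⟨ *-cancelˡ-≤ (D ^ (W₀ + W₀)) {{>-nonZero (^-positive d (W₀ + W₀))}} main ⟩
      d * N ^ (W₀ + n) * d ^ n    ∎))
    where
    open ≤-Reasoning
    d = suc d′
    D = suc d
    open Drift P S d W₀ step using (step′; V; Budgeted)
    open Potential P Budgeted V d (D ^ W₀) step′
    s₀ : Budgeted E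
    s₀ = W₀ , ≤-refl , s
    b = bad (W₀ + n) (run (W₀ + n) s₀)
    X = N ^ (W₀ + n)
    lem₁ : ∀ x y z u → x * (y * u * z) ≡ y * x * (z * u)
    lem₁ x y z u = solve (x ∙ y ∙ z ∙ u ∙ ε)
    lem₃ : suc D * d ≤ D * D
    lem₃ = ≤-trans (n≤1+n _) (≤-reflexive (lem d))
      where
      lem : ∀ d → suc (suc (suc d) * d) ≡ suc d * suc d
      lem d = solve (d ∙ ε)
    main : D ^ (W₀ + W₀) * (b * n * d ^ n) ≤ D ^ (W₀ + W₀) * (d * X * d ^ n)
    main = begin
      D ^ (W₀ + W₀) * (b * n * d ^ n)   ≡⟨ lem₁ (D ^ (W₀ + W₀)) b (d ^ n) n ⟩
      b * D ^ (W₀ + W₀) * (d ^ n * n)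
        ≤⟨ *-monoʳ-≤ (b * D ^ (W₀ + W₀)) (≤-trans (*-monoʳ-≤ (d ^ n) (m≤n+m n d)) (bernoulli d n)) ⟩
      b * D ^ (W₀ + W₀) * (d * D ^ n)
        ≡⟨ cong (λ x → b * x * (d * D ^ n)) (^-distribˡ-+-* D W₀ W₀) ⟩
      b * (D ^ W₀ * D ^ W₀) * (d * D ^ n)
        ≡⟨ lem₄ d b (D ^ W₀) (D ^ n) ⟩
      d * (D ^ W₀ * b * (D ^ W₀ * D ^ n))
        ≡⟨ cong (λ x → d * (D ^ W₀ * b * x)) (sym (^-distribˡ-+-* D W₀ n)) ⟩
      d * (D ^ W₀ * b * D ^ (W₀ + n))
        ≤⟨ *-monoʳ-≤ d (bad-run (W₀ + n) s₀) ⟩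
      d * (suc D ^ W₀ * D ^ (W₀ ∸ W₀) * (d ^ (W₀ + n) * X))
        ≡⟨ cong₂ (λ x y → d * (suc D ^ W₀ * x * (y * X))) (cong (D ^_) (n∸n≡0 W₀)) (^-distribˡ-+-* d W₀ n) ⟩
      d * (suc D ^ W₀ * 1 * (d ^ W₀ * d ^ n * X))
        ≡⟨ lem₅ d (suc D ^ W₀) (d ^ W₀) (d ^ n) X ⟩
      suc D ^ W₀ * d ^ W₀ * (d * X * d ^ n)
        ≤⟨ *-monoˡ-≤ (d * X * d ^ n) (≤-trans (≤-reflexive (^-*-distrib (suc D) d W₀))
             (≤-trans (^-monoˡ-≤ W₀ lem₃) (≤-reflexive (trans (sym (^-*-distrib D D W₀)) (sym (^-distribˡ-+-* D W₀ W₀)))))) ⟩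
      D ^ (W₀ + W₀) * (d * X * d ^ n) ∎
      where
      lem₄ : ∀ d b x y → b * (x * x) * (d * y) ≡ d * (x * b * (x * y))
      lem₄ d b x y = solve (d ∙ b ∙ x ∙ y ∙ ε)
      lem₅ : ∀ d x y z u → d * (x * 1 * (y * z * u)) ≡ x * y * (d * u * z)
      lem₅ d x y z u = solve (d ∙ x ∙ y ∙ z ∙ u ∙ ε)

-- Integer square roots for the cost of absorption

least : {P : ℕ → Set} → Decidable P → ∀ b → P b → Σ[ m ∈ ℕ ] (P m × (∀ {j} → P j → m ≤ j))
least P? zero    p = zero , p , λ _ → z≤n
least {P} P? (suc b) p with P? zero
... | yes p₀ = zero , p₀ , λ _ → z≤n
... | no ¬p₀ with least (P? ∘ suc) b p
...   | m , pm , min = suc m , pm , minimal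
  where
  minimal : ∀ {j} → P j → suc m ≤ j
  minimal {zero}  p₀ = ⊥-elim (¬p₀ p₀)
  minimal {suc j} pj = s≤s (min pj)

-- q κ ≈ √(n/κ) and s κ ≈ √(κn), so that q is at most a constant times the increment of s.
module Scale (n : ℕ) where

  -- The alternative `n ≤ q` provides a witness also for `κ = 0`, where the first one is impossible
  -- for positive `n`.
  q-spec : ∀ κ → Σ[ q ∈ ℕ ] (((n ≤ κ * (q * q)) ⊎ (n ≤ q)) ×
    (∀ {j} → (n ≤ κ * (j * j)) ⊎ (n ≤ j) → q ≤ j))
  q-spec κ = least (λ q → (n ≤? κ * (q * q)) ⊎-dec (n ≤? q)) n (inj₂ ≤-refl)

  s-spec : ∀ κ → Σ[ s ∈ ℕ ] ((κ * n ≤ s * s) × (∀ {j} → κ * n ≤ j * j → s ≤ j))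
  s-spec κ = least (λ s → κ * n ≤? s * s) (κ + n) (*-mono-≤ (m≤m+n κ n) (m≤n+m n κ))

  q s : ℕ → ℕ
  q κ = proj₁ (q-spec κ)
  s κ = proj₁ (s-spec κ)

  q-antitone : ∀ {κ λ′} → κ ≤ λ′ → q λ′ ≤ q κ
  q-antitone {κ} {λ′} κ≤λ = proj₂ (proj₂ (q-spec λ′)) (case proj₁ (proj₂ (q-spec κ)) of λ where
    (inj₁ p) → inj₁ (≤-trans p (*-monoˡ-≤ (q κ * q κ) κ≤λ))
    (inj₂ p) → inj₂ p)

  n≤κq² : ∀ κ → n ≤ suc κ * (q (suc κ) * q (suc κ))
  n≤κq² κ with proj₁ (proj₂ (q-spec (suc κ)))
  ... | inj₁ p = p
  ... | inj₂ p = ≤-trans p (≤-trans (m≤m*m (q (suc κ))) (m≤m+n _ _))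
    where
    m≤m*m : ∀ m → m ≤ m * m
    m≤m*m zero    = z≤n
    m≤m*m (suc m) = m≤m*n (suc m) (suc m)

  q-minimal : ∀ {κ j} → j < q κ → κ * (j * j) < n
  q-minimal {κ} {j} j<q = ≰⇒> λ p → <⇒≱ j<q (proj₂ (proj₂ (q-spec κ)) (inj₁ p))

  s-least : ∀ {κ j} → κ * n ≤ j * j → s κ ≤ j
  s-least {κ} = proj₂ (proj₂ (s-spec κ))

  s-minimal : ∀ {κ j} → j < s κ → j * j < κ * n
  s-minimal {κ} j<s = ≰⇒> λ p → <⇒≱ j<s (s-least {κ} p)

  κn≤s² : ∀ κ → κ * n ≤ s κ * s κ
  κn≤s² κ = proj₁ (proj₂ (s-spec κ))

  s-mono : ∀ {κ λ′} → κ ≤ λ′ → s κ ≤ s λ′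
  s-mono {κ} {λ′} κ≤λ = s-least {κ} (≤-trans (*-monoˡ-≤ n κ≤λ) (κn≤s² λ′))

  -- By minimality of `q`, the product of the number of vertices and `(q - 1)²` is below `n`;
  -- multiplying by that number again compares squares with `s`. The extra summand pays for rounding
  -- up.
  κq≤ : ∀ κ → suc κ * q (suc κ) ≤ suc κ + s (suc κ)
  κq≤ κ with q (suc κ) in eq
  ... | zero  = ≤-trans (≤-reflexive (*-zeroʳ κ)) z≤n
  ... | suc j = ≤-trans (≤-reflexive (*-suc (suc κ) j)) (+-monoʳ-≤ (suc κ)
      (≮⇒≥ λ s<κj → <⇒≱ (*-mono-< s<κj s<κj) (begin
        suc κ * j * (suc κ * j)    ≡⟨ lem κ j ⟩
        suc κ * (suc κ * (j * j))  ≤⟨ *-monoʳ-≤ (suc κ) (<⇒≤ (q-minimal {suc κ} (subst (j <_) (sym eq) ≤-refl))) ⟩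
        suc κ * n                  ≤⟨ κn≤s² (suc κ) ⟩
        s (suc κ) * s (suc κ)      ∎)))
    where
    open ≤-Reasoning
    lem : ∀ κ j → suc κ * j * (suc κ * j) ≡ suc κ * (suc κ * (j * j))
    lem κ j = solve (κ ∙ j ∙ ε)

  private
    -- Suppose `n` exceeds `16(κ + 1)D²`. Subtracting the two squares gives `n ≤ D(2a + D)`;
    -- squaring and `(x + y)² ≤ 2x² + 2y²` give `n² ≤ D²(8κn + 2n)`, which is too small.
    square-bound : ∀ κ a D → a * a < κ * n → suc κ * n ≤ (a + D) * (a + D) → 1 ≤ D →
      n ≤ suc κ * (4 * D * (4 * D))
    square-bound κ a D a²< ≤b² 1≤D with n ≤? suc κ * (4 * D * (4 * D))
    ... | yes p = p
    ... | no ¬p = ⊥-elim (<⇒≱ 1≤Z (+-cancelʳ-≤ (suc κ * (16 * Z)) (Z) 0 (begin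
        Z + suc κ * (16 * Z)
          ≡⟨ +-comm Z _ ⟩
        suc κ * (16 * Z) + Z
          ≤⟨ +-monoˡ-≤ Z (≤-trans (≤-reflexive lem₁) (*-monoˡ-≤ n (<⇒≤ n>))) ⟩
        n * n + Z
          ≤⟨ +-monoˡ-≤ Z (*-mono-≤ n≤ n≤) ⟩
        D * (2 * a + D) * (D * (2 * a + D)) + Z
          ≤⟨ +-monoˡ-≤ Z cauchy ⟩
        D * D * (8 * (a * a) + 2 * (D * D)) + Z
          ≤⟨ +-monoˡ-≤ Z (*-monoʳ-≤ (D * D) (+-mono-≤ (*-monoʳ-≤ 8 (<⇒≤ a²<)) (*-monoʳ-≤ 2 D²≤n))) ⟩
        D * D * (8 * (κ * n) + 2 * n) + Z
          ≤⟨ m≤m+n _ (8 * (κ * Z) + 13 * Z) ⟩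
        D * D * (8 * (κ * n) + 2 * n) + Z + (8 * (κ * Z) + 13 * Z)
          ≡⟨ lem₂ ⟩
        suc κ * (16 * Z) ∎)))
      where
      open ≤-Reasoning
      Z = D * D * n
      n> : suc κ * (4 * D * (4 * D)) < n
      n> = ≰⇒> ¬p
      1≤n : 1 ≤ n
      1≤n = ≤-trans (s≤s z≤n) n>
      1≤Z : 1 ≤ Z
      1≤Z = *-mono-≤ {1} {D * D} {1} {n} (*-mono-≤ {1} {D} {1} {D} 1≤D 1≤D) 1≤n
      D²≤n : D * D ≤ n
      D²≤n = ≤-trans (≤-trans (m≤m+n (D * D) (15 * (D * D) + κ * (4 * D * (4 * D)))) (≤-reflexive (lem κ D))) (<⇒≤ n>)
        where
        lem : ∀ κ D → D * D + (15 * (D * D) + κ * (4 * D * (4 * D))) ≡ suc κ * (4 * D * (4 * D))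
        lem κ D = solve (κ ∙ D ∙ ε)
      lem₁ : suc κ * (16 * (D * D * n)) ≡ suc κ * (4 * D * (4 * D)) * n
      lem₁ = solve (κ ∙ D ∙ n ∙ ε)
      lem₂ : D * D * (8 * (κ * n) + 2 * n) + D * D * n + (8 * (κ * (D * D * n)) + 13 * (D * D * n)) ≡ suc κ * (16 * (D * D * n))
      lem₂ = solve (κ ∙ D ∙ n ∙ ε)
      n≤ : n ≤ D * (2 * a + D)
      n≤ = lin 0 (+-mono-≤ ≤b² (<⇒≤ a²<)) (lem κ a D n)
        where
        lem : ∀ κ a D n → n + ((a + D) * (a + D) + κ * n) + 0 ≡ D * (2 * a + D) + (suc κ * n + a * a)
        lem κ a D n = solve (κ ∙ a ∙ D ∙ n ∙ ε)
      cauchy : D * (2 * a + D) * (D * (2 * a + D)) ≤ D * D * (8 * (a * a) + 2 * (D * D))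
      cauchy = ≤-trans (≤-reflexive (lem a D)) (*-monoʳ-≤ (D * D) ([ case₁ , case₂ ]′ (≤-total (2 * a) D)))
        where
        lem : ∀ a D → D * (2 * a + D) * (D * (2 * a + D)) ≡ D * D * ((2 * a + D) * (2 * a + D))
        lem a D = solve (a ∙ D ∙ ε)
        Goal = (2 * a + D) * (2 * a + D) ≤ 8 * (a * a) + 2 * (D * D)
        case₁ : 2 * a ≤ D → Goal
        case₁ p with m≤n⇒∃[o]m+o≡n p
        ... | o , refl = ≤-trans (m≤m+n _ (o * o)) (≤-reflexive (lem′ a o))
          where
          lem′ : ∀ a o → (2 * a + (2 * a + o)) * (2 * a + (2 * a + o)) + o * o ≡ 8 * (a * a) + 2 * ((2 * a + o) * (2 * a + o))
          lem′ a o = solve (a ∙ o ∙ ε)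
        case₂ : D ≤ 2 * a → Goal
        case₂ p with m≤n⇒∃[o]m+o≡n p
        ... | o , eq = ≤-trans (m≤m+n _ (o * o)) (≤-reflexive (trans (cong (λ x → (x + D) * (x + D) + o * o) (sym eq))
            (trans (lem′ D o) (cong (_+ 2 * (D * D)) (trans (cong (λ x → 2 * (x * x)) eq) (lem″ a))))))
          where
          lem′ : ∀ D o → ((D + o) + D) * ((D + o) + D) + o * o ≡ 2 * ((D + o) * (D + o)) + 2 * (D * D)
          lem′ D o = solve (D ∙ o ∙ ε)
          lem″ : ∀ a → 2 * (2 * a * (2 * a)) ≡ 8 * (a * a)
          lem″ a = solve (a ∙ ε)

  -- The discrete form of `√(n/κ) = O(√(κn) - √((κ-1)n))`. Up to rounding the costs `q` telescope
  -- against `4 * s`, so their sum over all links is linear in `n`.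
  q≤Δs : ∀ κ → q (suc κ) + 4 * s κ ≤ 4 + 4 * s (suc κ)
  q≤Δs κ with m≤n⇒∃[o]m+o≡n (s-mono (n≤1+n κ))
  ... | o , eq = begin
    q (suc κ) + 4 * s κ          ≤⟨ +-monoˡ-≤ (4 * s κ) (proj₂ (proj₂ (q-spec (suc κ))) {4 * suc o} (inj₁ main)) ⟩
    4 * suc o + 4 * s κ          ≡⟨ lem o (s κ) ⟩
    4 + 4 * (s κ + o)            ≡⟨ cong (λ x → 4 + 4 * x) eq ⟩
    4 + 4 * s (suc κ)            ∎
    where
    open ≤-Reasoning
    lem : ∀ o x → 4 * suc o + 4 * x ≡ 4 + 4 * (x + o)
    lem o x = solve (o ∙ x ∙ ε)
    main : n ≤ suc κ * (4 * suc o * (4 * suc o))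
    main with s κ in sκ
    ... | suc a = square-bound κ a (suc o) (s-minimal {κ} (subst (a <_) (sym sκ) ≤-refl))
      (≤-trans (κn≤s² (suc κ)) (≤-reflexive (cong (λ x → x * x) (trans (sym eq) (sym (+-suc a o)))))) (s≤s z≤n)
    -- Here `s κ` has no predecessor to which minimality could apply, but `o` is all of `s (suc κ)`.
    ... | zero  = begin
      n                                  ≤⟨ m≤m+n n _ ⟩
      suc κ * n                          ≤⟨ κn≤s² (suc κ) ⟩
      s (suc κ) * s (suc κ)              ≡⟨ cong (λ x → x * x) (sym eq) ⟩
      o * o                              ≤⟨ m≤m+n (o * o) (15 * (o * o) + 32 * o + 16 + κ * (4 * suc o * (4 * suc o))) ⟩
      o * o + (15 * (o * o) + 32 * o + 16 + κ * (4 * suc o * (4 * suc o))) ≡⟨ lem′ κ o ⟩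
      suc κ * (4 * suc o * (4 * suc o))  ∎
      where
      lem′ : ∀ κ o → o * o + (15 * (o * o) + 32 * o + 16 + κ * (4 * suc o * (4 * suc o))) ≡ suc κ * (4 * suc o * (4 * suc o))
      lem′ κ o = solve (κ ∙ o ∙ ε)

-- Lists up to permutation

unique-↭ : {A : Set} {xs ys : List A} → xs ↭ ys → Unique xs → Unique ys
unique-↭ _↭_.refl u = u
unique-↭ (prep x p) (x∉ ∷ u) = All-resp-↭ p x∉ ∷ unique-↭ p u
unique-↭ (swap x y p) ((x≢y ∷ x∉) ∷ y∉ ∷ u) =
  ((x≢y ∘ sym) ∷ All-resp-↭ p y∉) ∷ All-resp-↭ p x∉ ∷ unique-↭ p u
unique-↭ (_↭_.trans p q) u = unique-↭ q (unique-↭ p u)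

unique-++ˡ : {A : Set} (xs : List A) {ys : List A} → Unique (xs ++ ys) → Unique xs
unique-++ˡ []       u        = []
unique-++ˡ (x ∷ xs) (x∉ ∷ u) = All.++⁻ˡ xs x∉ ∷ unique-++ˡ xs u

unique-++ʳ : {A : Set} (xs : List A) {ys : List A} → Unique (xs ++ ys) → Unique ys
unique-++ʳ []       u       = u
unique-++ʳ (x ∷ xs) (_ ∷ u) = unique-++ʳ xs u

unique-disjoint : {A : Set} (xs : List A) {ys : List A} → Unique (xs ++ ys) → ∀ {x y} → x ∈ xs → y ∈ ys → x ≢ y
unique-disjoint (x ∷ xs) (x∉ ∷ u) (here refl) y∈ = All.lookup x∉ (∈-++⁺ʳ xs y∈)
unique-disjoint (x ∷ xs) (x∉ ∷ u) (there x∈)  y∈ = unique-disjoint xs u x∈ y∈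

pick : {A : Set} {x : A} {xs : List A} → x ∈ xs → Σ[ ys ∈ List A ] (xs ↭ x ∷ ys)
pick x∈ with ∈-∃++ x∈
... | as , bs , refl = as ++ bs , shift _ as bs

take-split : ∀ {A : Set} g (xs : List A) → g ≤ length xs → Σ[ ys ∈ List A ] Σ[ zs ∈ List A ] (xs ≡ ys ++ zs × length ys ≡ g)
take-split zero    xs       _        = [] , xs , refl , refl
take-split (suc g) (x ∷ xs) (s≤s g≤) with take-split g xs g≤
... | ys , zs , refl , refl = x ∷ ys , zs , refl , refl

length-cartesianProduct : {A B : Set} (xs : List A) (ys : List B) → length (cartesianProduct xs ys) ≡ length xs * length ys
length-cartesianProduct []       ys = refl
length-cartesianProduct (x ∷ xs) ys = trans (length-++ (map (x ,_) ys))
  (cong₂ _+_ (length-map (x ,_) ys) (length-cartesianProduct xs ys))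

record Pairs {A : Set} (m : ℕ) (R : A → A → Set) : Set where
  constructor mkPairs
  field
    pairs  : List (A × A)
    unique : Unique pairs
    proper : All (λ p → proj₁ p ≢ proj₂ p) pairs
    size   : m ≤ length pairs
    sound  : ∀ {a b} → (a , b) ∈ pairs → R a b

-- Half of the list is paired with the other half, so that both entries of a pair are automatically distinct.
splitPairs : ∀ {A : Set} g (xs : List A) → Unique xs → 2 * g ≤ length xs →
  Pairs (g * g) (λ a b → Σ[ ys ∈ List A ] (xs ↭ a ∷ b ∷ ys))
splitPairs g xs u 2g≤ with take-split g xs (≤-trans (m≤m+n g _) 2g≤)
... | ys , zs , refl , refl = mkPairs (cartesianProduct ys zs)
    (Unique.cartesianProduct⁺ (unique-++ˡ ys u) (unique-++ʳ ys u))
    (All.tabulate (λ p∈ → unique-disjoint ys u (proj₁ (∈-cartesianProduct⁻ ys zs p∈)) (proj₂ (∈-cartesianProduct⁻ ys zs p∈))))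
    (≤-trans (*-monoʳ-≤ g g≤) (≤-reflexive (sym (length-cartesianProduct ys zs))))
    λ p∈ → case ∈-cartesianProduct⁻ ys zs p∈ of λ where
      (a∈ , b∈) → case pick a∈ of λ where
        (ys′ , p) → case pick b∈ of λ where
          (zs′ , r) → ys′ ++ zs′ , ↭-trans (++⁺ p r) (prep _ (shift _ ys′ zs′))
  where
  g≤ : g ≤ length zs
  g≤ = +-cancelˡ-≤ g _ _ (≤-trans (≤-reflexive (cong (g +_) (sym (+-identityʳ g)))) (≤-trans 2g≤ (≤-reflexive (length-++ ys))))

advance : ∀ {n m d W E} {R : Fin n → Fin n → Set} {S : ℕ → Edges n → Set} gain rest → gain ≤ suc d →
  rest + gain ≤ W → 2 * (n * n) ≤ m * gain → Pairs m R →
  (∀ {a b} → R a b → Σ[ c ∈ Fin n ] ((c ≢ a) × (c ≢ b) × S rest (triple a b c ∷ E))) → Progress S d W E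
advance gain rest gain≤ budget enough (mkPairs ps u pr size sound) respond =
  progress gain rest ps gain≤ budget u pr (≤-trans enough (*-monoˡ-≤ gain size)) (respond ∘ sound)

-- Loose paths

-- The list holds all vertices after the start, fillers and links in turn, so joining two paths is
-- `++`.
data Path {n : ℕ} (E : Edges n) : Fin n → List (Fin n) → Fin n → Set where
  stop : ∀ {u} → Path E u [] u
  _∷_  : ∀ {u a b vs v} → triple u a b ∈ E → Path E b vs v → Path E u (a ∷ b ∷ vs) v

Path-⊆ : ∀ {n} {E F : Edges n} {u vs v} → (∀ {e} → e ∈ E → e ∈ F) → Path E u vs v → Path F u vs v
Path-⊆ E⊆F stop    = stop
Path-⊆ E⊆F (e ∷ p) = E⊆F e ∷ Path-⊆ E⊆F p

_⟫_ : ∀ {n} {E : Edges n} {u vs v ws w} → Path E u vs v → Path E v ws w → Path E u (vs ++ ws) w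
stop    ⟫ r = r
(e ∷ p) ⟫ r = e ∷ (p ⟫ r)

Path-even : ∀ {n} {E : Edges n} {u vs v} → Path E u vs v → Σ[ k ∈ ℕ ] (length vs ≡ 2 * k)
Path-even stop    = 0 , refl
Path-even (e ∷ p) with Path-even p
... | k , eq = suc k , trans (cong (2 +_) eq) (sym (*-suc 2 k))

closePath : ∀ {n} {E : Edges n} {w u vs v f} → Path E u vs v → triple v f w ∈ E →
  All (_∈ E) (cycleGo w (u ∷ vs ++ [ f ]))
closePath stop    e′ = e′ ∷ []
closePath (e ∷ p) e′ = e ∷ closePath p e′

-- Links and fillers live in separate vectors: an exchange is then an update of one vector, and the
-- path is woven together only when the cycle is closed.
weave : ∀ {n k} → Vec (Fin n) (suc k) → Vec (Fin n) k → List (Fin n)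
weave (x ∷ xs)     []       = []
weave (x ∷ y ∷ xs) (m ∷ ms) = m ∷ y ∷ weave (y ∷ xs) ms

weave-↭ : ∀ {n k} (xs : Vec (Fin n) (suc k)) ms → lookup xs zero ∷ weave xs ms ↭ toList xs ++ toList ms
weave-↭ (x ∷ [])     []       = ↭-refl
weave-↭ (x ∷ y ∷ xs) (m ∷ ms) = prep x (↭-trans (prep m (weave-↭ (y ∷ xs) ms))
  (↭-sym (shift m (toList (y ∷ xs)) (toList ms))))

left right : ∀ {n k} → Vec (Fin n) (suc k) → Fin k → Fin n
left  xs i = lookup xs (inject₁ i)
right xs i = lookup xs (suc i)

endpoint : ∀ {n k} → Vec (Fin n) (suc k) → Fin n
endpoint (x ∷ [])     = x
endpoint (x ∷ y ∷ xs) = endpoint (y ∷ xs)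

weavePath : ∀ {n} {E : Edges n} {k} (xs : Vec (Fin n) (suc k)) (ms : Vec (Fin n) k) →
  (∀ i → triple (left xs i) (lookup ms i) (right xs i) ∈ E) → Path E (lookup xs zero) (weave xs ms) (endpoint xs)
weavePath (x ∷ [])     []       es = stop
weavePath (x ∷ y ∷ xs) (m ∷ ms) es = es zero ∷ weavePath (y ∷ xs) ms (es ∘ suc)

closeCycle : ∀ {n} {E : Edges n} {h vs v t f f′} → Path E h vs v → triple t f h ∈ E → triple v f′ t ∈ E →
  t ∷ f ∷ h ∷ vs ++ [ f′ ] ↭ allFin n → HasLooseHC E
closeCycle p e e′ vs↭ = _ , vs↭ , closePath (e ∷ p) e′

module ++-Solver {n : ℕ} = CommutativeMonoidSolver (++-commutativeMonoid {A = Fin n})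

-- By `ω-large` and `hits-count`, an offer hits a given family of `g * g` distinct proper pairs with
-- probability at least `2 / ω`; a step that waits for such a family is therefore credited with the
-- gain `ω`.
module Phases (n g ω : ℕ) (1≤g : 1 ≤ g) (100g≤n : 100 * g ≤ n)
  (ω-large : 2 * (n * n) ≤ ω * (g * g)) where

  open ++-Solver {n} using (_⊕_; _⊜_) renaming (solve to solve-↭)

  k : ℕ
  k = 10 * g

  k≤n : k ≤ n
  k≤n = ≤-trans (*-monoˡ-≤ g (m≤m+n 10 90)) 100g≤n

  n≢0 : n ≢ 0
  n≢0 eq = <⇒≱ (≤-trans 1≤g (≤-trans (m≤n*m g 100) 100g≤n)) (≤-reflexive eq)

  unique-V : {xs : List (Fin n)} → xs ↭ allFin n → Unique xs
  unique-V p = unique-↭ (↭-sym p) (Unique.allFin⁺ n)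

  length-V : {xs : List (Fin n)} → xs ↭ allFin n → length xs ≡ n
  length-V p = trans (↭-length p) (length-tabulate {n = n} id)

  enough-pairs : ∀ {x} → g * g ≤ x → 2 * (n * n) ≤ x * ω
  enough-pairs {x} g²≤ = ≤-trans ω-large (≤-trans (≤-reflexive (*-comm ω (g * g))) (*-monoˡ-≤ ω g²≤))

  -- The initial path

  -- The newest link comes first, so the chain grows at its head. The last head becomes `x₀`, where
  -- the path is later prolonged.
  record Chain (j : ℕ) (E : Edges n) : Set where
    constructor chain
    field
      xs    : Vec (Fin n) (suc j)
      ms    : Vec (Fin n) j
      free  : List (Fin n)
      links : ∀ i → triple (left xs i) (lookup ms i) (right xs i) ∈ E
      all   : toList xs ++ toList ms ++ free ↭ allFin n

  record Chain₁ (W : ℕ) (E : Edges n) : Set where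
    constructor chain₁
    field
      {j} todo : ℕ
      j+todo   : j + todo ≡ k
      budget   : ω * todo ≤ W
      built    : Chain j E

  step₁ : ∀ {W E} → Chain₁ W E → Chain k E ⊎ Progress Chain₁ (suc ω) W E
  step₁ {W} {E} (chain₁ {j} zero eq _ c) = inj₁ (subst (λ j → Chain j E) (trans (sym (+-identityʳ j)) eq) c)
  step₁ {W} {E} (chain₁ {j} (suc r) eq ωr≤ (chain (h ∷ xs) ms U es perm)) =
    inj₂ (advance ω (ω * r) (m≤n+m ω 2) (≤-trans (≤-reflexive (trans (+-comm _ ω) (sym (*-suc ω r)))) ωr≤) (enough-pairs ≤-refl) (splitPairs g U unique-U 2g≤) respond)
    where
    unique-U : Unique U
    unique-U = unique-++ʳ (toList ms) (unique-++ʳ (toList (h ∷ xs)) (unique-V perm))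
    size : suc j + (j + length U) ≡ n
    size = trans (sym (trans (length-++ (toList (h ∷ xs))) (cong₂ _+_ (Vec.length-toList (h ∷ xs))
      (trans (length-++ (toList ms)) (cong (_+ length U) (Vec.length-toList ms)))))) (length-V perm)
    2g≤ : 2 * g ≤ length U
    2g≤ = lin (78 * g + r + (1 + r)) (+-mono-≤ 100g≤n (≤-reflexive (cong₂ (λ x y → x + (y + y)) (sym size) eq)))
      (lem g n j (length U) r)
      where
      lem : ∀ g n j u r → 2 * g + (n + (suc j + (j + u) + (10 * g + 10 * g))) + (78 * g + r + (1 + r)) ≡
        u + (100 * g + (n + ((j + suc r) + (j + suc r))))
      lem g n j u r = solve (g ∙ n ∙ j ∙ u ∙ r ∙ ε)
    respond : ∀ {a b} → Σ[ U′ ∈ List (Fin n) ] (U ↭ a ∷ b ∷ U′) →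
      Σ[ c ∈ Fin n ] ((c ≢ a) × (c ≢ b) × Chain₁ (ω * r) (triple a b c ∷ E))
    respond {a} {b} (U′ , U↭) = h , h≢ (here refl) , h≢ (there (here refl)) ,
        chain₁ r (trans (sym (+-suc j r)) eq) ≤-refl (chain (b ∷ h ∷ xs) (a ∷ ms) U′ es′ perm′)
      where
      h≢ : ∀ {x} → x ∈ a ∷ b ∷ U′ → h ≢ x
      h≢ x∈ = unique-disjoint (toList (h ∷ xs)) (unique-V perm) (here refl)
        (∈-++⁺ʳ (toList ms) (∈-resp-↭ (↭-sym U↭) x∈))
      es′ : ∀ i → triple (left (b ∷ h ∷ xs) i) (lookup (a ∷ ms) i) (right (b ∷ h ∷ xs) i) ∈ triple a b h ∷ E
      es′ zero    = here (triple-swap b a h)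
      es′ (suc i) = there (es i)
      perm′ : toList (b ∷ h ∷ xs) ++ toList (a ∷ ms) ++ U′ ↭ allFin n
      perm′ = ↭-trans (solve-↭ 5 (λ a b X M U → (b ⊕ (X ⊕ (a ⊕ (M ⊕ U)))) ⊜ (X ⊕ (M ⊕ (a ⊕ (b ⊕ U))))) ↭-refl
          [ a ] [ b ] (toList (h ∷ xs)) (toList ms) U′)
        (↭-trans (++⁺ˡ (toList (h ∷ xs)) (++⁺ˡ (toList ms) (↭-sym U↭))) perm)

  phase₁ : ∀ {E} → Wins (Chain k) (ω * n + n) E (suc ω)
  phase₁ = drift step₁ start
    where
    start : ∀ {E} → Chain₁ (ω * n) E
    start with allFin n in eq | n≢0
    ... | x ∷ xs | _ = chain₁ k refl (*-monoʳ-≤ ω k≤n) (chain (x ∷ []) [] xs (λ ()) (↭-reflexive (sym eq)))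
    ... | []     | p = ⊥-elim (p (trans (sym (length-tabulate {n = n} id)) (cong length eq)))

-- Random fillers for the gadgets

sublists : {A : Set} → List A → List (List A)
sublists []       = [ [] ]
sublists (x ∷ xs) = map (x ∷_) (sublists xs) ++ sublists xs

length-sublists : {A : Set} (xs : List A) → length (sublists xs) ≡ 2 ^ length xs
length-sublists []       = refl
length-sublists (x ∷ xs) = trans (length-++ (map (x ∷_) (sublists xs)))
  (trans (cong (_+ length (sublists xs)) (length-map (x ∷_) (sublists xs)))
    (trans (cong (λ m → m + m) (length-sublists xs)) (cong (2 ^ length xs +_) (sym (+-identityʳ _)))))

filter∈sublists : {A : Set} {P : A → Set} (P? : Decidable P) (xs : List A) → filter P? xs ∈ sublists xs
filter∈sublists P? []       = here refl
filter∈sublists P? (x ∷ xs) with P? x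
... | yes _ = ∈-++⁺ˡ (∈-map⁺ (x ∷_) (filter∈sublists P? xs))
... | no  _ = ∈-++⁺ʳ (map (x ∷_) (sublists xs)) (filter∈sublists P? xs)

sublists-⊆ : {A : Set} (xs : List A) {ys : List A} → ys ∈ sublists xs → ∀ {y} → y ∈ ys → y ∈ xs
sublists-⊆ []       (here refl) ()
sublists-⊆ (x ∷ xs) ys∈ y∈ with ∈-++⁻ (map (x ∷_) (sublists xs)) ys∈
... | inj₂ p = there (sublists-⊆ xs p y∈)
... | inj₁ p with ∈-map⁻ (x ∷_) p
...   | zs , zs∈ , refl with y∈
...     | here eq   = here eq
...     | there y∈′ = there (sublists-⊆ xs zs∈ y∈′)

unique-sublists : {A : Set} {xs : List A} → Unique xs → ∀ {ys} → ys ∈ sublists xs → Unique ys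
unique-sublists {xs = []} _ (here refl) = []
unique-sublists {xs = x ∷ xs} (x∉ ∷ u) ys∈ with ∈-++⁻ (map (x ∷_) (sublists xs)) ys∈
... | inj₂ p = unique-sublists u p
... | inj₁ p with ∈-map⁻ (x ∷_) p
...   | zs , zs∈ , refl = All.tabulate (λ z∈ → All.lookup x∉ (sublists-⊆ xs zs∈ z∈)) ∷ unique-sublists u zs∈

lookup∈ : ∀ {A : Set} {k} (xs : Vec A k) i → lookup xs i ∈ toList xs
lookup∈ (x ∷ xs) zero    = here refl
lookup∈ (x ∷ xs) (suc i) = there (lookup∈ xs i)

lookup-injective : ∀ {A : Set} {k} (xs : Vec A k) → Unique (toList xs) → ∀ {i j} → lookup xs i ≡ lookup xs j → i ≡ j
lookup-injective (x ∷ xs) (x∉ ∷ u) {zero}  {zero}  eq = refl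
lookup-injective (x ∷ xs) (x∉ ∷ u) {zero}  {suc j} eq = ⊥-elim (All.lookup x∉ (lookup∈ xs j) eq)
lookup-injective (x ∷ xs) (x∉ ∷ u) {suc i} {zero}  eq = ⊥-elim (All.lookup x∉ (lookup∈ xs i) (sym eq))
lookup-injective (x ∷ xs) (x∉ ∷ u) {suc i} {suc j} eq = cong suc (lookup-injective xs u eq)

inject₁≢suc : ∀ {k} (i : Fin k) → inject₁ i ≢ suc i
inject₁≢suc (suc i) eq = inject₁≢suc i (Fin.suc-injective eq)

n≤2^n : ∀ n → n ≤ 2 ^ n
n≤2^n zero    = z≤n
n≤2^n (suc n) = ≤-trans (+-mono-≤ (^-positive 1 n) (n≤2^n n)) (+-monoʳ-≤ (2 ^ n) (m≤m+n (2 ^ n) 0))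

module Fillers (n g ω : ℕ) (ω-large : 2 * (n * n) ≤ ω * (g * g))
  {k : ℕ} (xs : Vec (Fin n) (suc k)) (F : List (Fin n)) (all : toList xs ++ F ↭ allFin n) where

  private
    unique-all : Unique (toList xs ++ F)
    unique-all = unique-↭ (↭-sym all) (Unique.allFin⁺ n)

  unique-F : Unique F
  unique-F = unique-++ʳ (toList xs) unique-all

  link≢filler : ∀ {j f} → f ∈ F → lookup xs j ≢ f
  link≢filler {j} f∈ = unique-disjoint (toList xs) unique-all (lookup∈ xs j) f∈

  link-injective : ∀ {i j} → lookup xs i ≡ lookup xs j → i ≡ j
  link-injective = lookup-injective xs (unique-++ˡ (toList xs) unique-all)

  Fill : Edges n → Fin k → Fin n → Set
  Fill E i f = triple (left xs i) f (right xs i) ∈ E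

  Joined : Edges n → List (Fin k) × List (Fin n) → Set
  Joined E (A , S) = Σ[ i ∈ Fin k ] Σ[ f ∈ Fin n ] ((i ∈ A) × (f ∈ S) × Fill E i f)

  Large : List (Fin k) × List (Fin n) → Set
  Large (A , S) = (g ≤ length A) × (g ≤ length S)

  large? : Decidable Large
  large? (A , S) = (g ≤? length A) ×-dec (g ≤? length S)

  tests : List (List (Fin k) × List (Fin n))
  tests = filter large? (cartesianProduct (sublists (allFin k)) (sublists F))

  Mixing : Edges n → Set
  Mixing E = ∀ {AS} → AS ∈ tests → Joined E AS

  -- Only the right link enters the offer: it determines the gadget, and the left link is kept as
  -- the answer.
  crossing : List (Fin k) × List (Fin n) → List (Fin n × Fin n)
  crossing (A , S) = cartesianProduct (map (right xs) A) S

  test⁻ : ∀ {A S} → (A , S) ∈ tests → Unique A × (Unique S × (∀ {f} → f ∈ S → f ∈ F)) × Large (A , S)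
  test⁻ AS∈ with ∈-filter⁻ large? {xs = cartesianProduct (sublists (allFin k)) (sublists F)} AS∈
  ... | AS∈′ , large with ∈-cartesianProduct⁻ (sublists (allFin k)) (sublists F) AS∈′
  ...   | A∈ , S∈ = unique-sublists (Unique.allFin⁺ k) A∈ , (unique-sublists unique-F S∈ , sublists-⊆ F S∈) , large

  private
    N : ℕ
    N = length (offers n)

  crossing-count : ∀ {AS} → AS ∈ tests → N ≤ suc ω * ∑ (offers n) (λ o → [ hits? (crossing AS) o ]ᵈ)
  crossing-count {A , S} AS∈ with test⁻ AS∈
  ... | uA , (uS , S⊆) , (g≤A , g≤S) = *-cancelˡ-≤ 4 (begin
      4 * N                     ≡⟨ lem₁ N ⟩
      2 * (2 * N)               ≤⟨ *-monoʳ-≤ 2 (2*length-offers≤n² n) ⟩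
      2 * (n * n)               ≤⟨ ω-large ⟩
      ω * (g * g)               ≤⟨ *-mono-≤ (n≤1+n ω) (≤-trans (*-mono-≤ g≤A g≤S) (≤-reflexive (sym
                                     (trans (length-cartesianProduct (map (right xs) A) S) (cong (_* length S) (length-map (right xs) A)))))) ⟩
      suc ω * length (crossing (A , S))
        ≤⟨ *-monoʳ-≤ (suc ω) (hits-count
             (Unique.cartesianProduct⁺ (Unique.map⁺ (Fin.suc-injective ∘ link-injective) uA) uS)
             (All.tabulate λ p∈ → case ∈-cartesianProduct⁻ (map (right xs) A) S p∈ of λ where
               (a∈ , b∈) → case ∈-map⁻ (right xs) a∈ of λ where
                 (i , _ , eq) → λ a≡b → link≢filler {suc i} (S⊆ b∈) (trans (sym eq) a≡b))) ⟩
      suc ω * (2 * p)           ≤⟨ m≤m+n _ (suc ω * (2 * p)) ⟩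
      suc ω * (2 * p) + suc ω * (2 * p) ≡⟨ lem₂ ω p ⟩
      4 * (suc ω * p)           ∎)
    where
    open ≤-Reasoning
    p = ∑ (offers n) (λ o → [ hits? (crossing (A , S)) o ]ᵈ)
    lem₁ : ∀ x → 4 * x ≡ 2 * (2 * x)
    lem₁ x = solve (x ∙ ε)
    lem₂ : ∀ ω p → suc ω * (2 * p) + suc ω * (2 * p) ≡ 4 * (suc ω * p)
    lem₂ ω p = solve (ω ∙ p ∙ ε)

  IsRight : Fin n → Set
  IsRight a = Σ[ i ∈ Fin k ] (right xs i ≡ a)

  isRight? : ∀ a → Dec (IsRight a)
  isRight? a = Fin.any? (λ i → right xs i Fin.≟ a)

  _∈F? : ∀ f → Dec (f ∈ F)
  f ∈F? = any? (f Fin.≟_) F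

  -- One answer, chosen without regard to the tests, serves every test that the offer hits. The
  -- union bound over exponentially many tests rests on this.
  Answers : Edges n → (o : Offer n) → Maybe (Choice o) → Set
  Answers E o c = ∀ {AS} → AS ∈ tests → Hits (crossing AS) o → Joined (extend E o c) AS

  crossing⁻ : ∀ {A S a b} → (A , S) ∈ tests → (a , b) ∈ crossing (A , S) →
    Σ[ i ∈ Fin k ] (right xs i ≡ a × (i ∈ A) × (b ∈ S) × (b ∈ F))
  crossing⁻ {A} {S} AS∈ ab∈ with ∈-cartesianProduct⁻ (map (right xs) A) S ab∈
  ... | a∈ , b∈ with ∈-map⁻ (right xs) a∈
  ...   | i , i∈ , refl = i , refl , i∈ , b∈ , proj₂ (proj₁ (proj₂ (test⁻ AS∈))) b∈

  answer : ∀ E o → Σ[ c ∈ Maybe (Choice o) ] Answers E o c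
  answer E o@((a , b) , _) with isRight? a ×-dec (b ∈F?) | isRight? b ×-dec (a ∈F?)
  ... | yes ((i , refl) , b∈F) | _ = just (left xs i , (λ eq → inject₁≢suc i (link-injective eq)) , link≢filler b∈F) , λ where
    AS∈ (inj₁ h) → case crossing⁻ AS∈ h of λ where
      (i′ , eq , i∈ , b∈S , _) → case link-injective {suc i′} {suc i} eq of λ where
        refl → i , b , i∈ , b∈S , here (triple-rev (left xs i) b (right xs i))
    AS∈ (inj₂ h) → case crossing⁻ AS∈ h of λ where
      (i′ , eq , _ , _ , a∈F) → ⊥-elim (link≢filler {suc i} a∈F refl)
  ... | no ¬p | yes ((i , refl) , a∈F) = just (left xs i , link≢filler a∈F , (λ eq → inject₁≢suc i (link-injective eq))) , λ where
    AS∈ (inj₁ h) → case crossing⁻ AS∈ h of λ where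
      (i′ , eq , _ , _ , b∈F) → ⊥-elim (¬p ((i′ , eq) , b∈F))
    AS∈ (inj₂ h) → case crossing⁻ AS∈ h of λ where
      (i′ , eq , i∈ , a∈S , _) → case link-injective {suc i′} {suc i} eq of λ where
        refl → i , a , i∈ , a∈S , here (triple-rot (left xs i) a (right xs i))
  ... | no ¬p | no ¬q = nothing , λ where
    AS∈ (inj₁ h) → case crossing⁻ AS∈ h of λ where
      (i , eq , _ , _ , b∈F) → ⊥-elim (¬p ((i , eq) , b∈F))
    AS∈ (inj₂ h) → case crossing⁻ AS∈ h of λ where
      (i , eq , _ , _ , a∈F) → ⊥-elim (¬q ((i , eq) , a∈F))

  record Testing (E : Edges n) : Set where
    constructor testing
    field
      pending : List (List (Fin k) × List (Fin n))
      valid   : All (_∈ tests) pending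
      passed  : ∀ {AS} → AS ∈ tests → (AS ∈ pending) ⊎ Joined E AS

  misses? : ∀ o → Decidable (λ AS → ¬ Hits (crossing AS) o)
  misses? o AS = ¬? (hits? (crossing AS) o)

  retest : ∀ {E} → Testing E → ∀ o → Σ[ c ∈ Maybe (Choice o) ] Testing (extend E o c)
  retest {E = E} (testing pending valid passed) o with answer E o
  ... | c , joins = c , testing (filter (misses? o) pending) (All.filter⁺ (misses? o) valid) passed′
    where
    passed′ : ∀ {AS} → AS ∈ tests → (AS ∈ filter (misses? o) pending) ⊎ Joined (extend E o c) AS
    passed′ {AS} AS∈ with passed AS∈ | hits? (crossing AS) o
    ... | inj₂ (i , f , i∈ , f∈ , e) | _    = inj₂ (i , f , i∈ , f∈ , extend-⊆ E o c e)
    ... | inj₁ p                  | yes h = inj₂ (joins AS∈ h)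
    ... | inj₁ p                  | no ¬h = inj₁ (∈-filter⁺ (misses? o) p ¬h)

  retest-pending : ∀ {E} (s : Testing E) o →
    Testing.pending (proj₂ (retest s o)) ≡ filter (misses? o) (Testing.pending s)
  retest-pending {E = E} s o with answer E o
  ... | c , joins = refl

  open Testing

  misses+hits : ∀ AS → ∑ (offers n) (λ o → [ misses? o AS ]ᵈ) + ∑ (offers n) (λ o → [ hits? (crossing AS) o ]ᵈ) ≡ N
  misses+hits AS = trans (sym (∑-+ (offers n) _ _)) (trans (∑-cong (offers n) lem) (trans (∑-const (offers n) 1) (*-identityʳ N)))
    where
    lem : ∀ o → [ misses? o AS ]ᵈ + [ hits? (crossing AS) o ]ᵈ ≡ 1
    lem o with hits? (crossing AS) o
    ... | yes _ = refl
    ... | no _  = refl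

  misses-bound : ∀ {AS} → AS ∈ tests → suc ω * ∑ (offers n) (λ o → [ misses? o AS ]ᵈ) ≤ ω * N
  misses-bound {AS} AS∈ = +-cancelʳ-≤ N _ _ (begin
      suc ω * m + N          ≤⟨ +-monoʳ-≤ (suc ω * m) (crossing-count AS∈) ⟩
      suc ω * m + suc ω * p  ≡⟨ sym (*-distribˡ-+ (suc ω) m p) ⟩
      suc ω * (m + p)        ≡⟨ cong (suc ω *_) (misses+hits AS) ⟩
      suc ω * N              ≡⟨ +-comm N (ω * N) ⟩
      ω * N + N              ∎)
    where
    open ≤-Reasoning
    m = ∑ (offers n) (λ o → [ misses? o AS ]ᵈ)
    p = ∑ (offers n) (λ o → [ hits? (crossing AS) o ]ᵈ)

  -- Linearity of expectation over the pending tests, each of which survives a round with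
  -- probability at most `ω / (ω + 1)`.
  retest-drift : ∀ {E} (s : Testing E) →
    suc ω * ∑ (offers n) (λ o → length (pending (proj₂ (retest s o)))) ≤ ω * (N * length (pending s))
  retest-drift s = begin
    suc ω * ∑ (offers n) (λ o → length (pending (proj₂ (retest s o))))
      ≡⟨ cong (suc ω *_) (trans (∑-cong (offers n) (λ o → trans (cong length (retest-pending s o)) (∑-filter (misses? o) (pending s))))
           (∑-swap (offers n) (pending s) _)) ⟩
    suc ω * ∑ (pending s) (λ AS → ∑ (offers n) (λ o → [ misses? o AS ]ᵈ))
      ≤⟨ bound (valid s) ⟩
    length (pending s) * (ω * N)
      ≡⟨ lem (length (pending s)) ω N ⟩
    ω * (N * length (pending s)) ∎
    where
    open ≤-Reasoning
    lem : ∀ l w m → l * (w * m) ≡ w * (m * l)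
    lem l w m = solve (l ∙ w ∙ m ∙ ε)
    bound : ∀ {ps} → All (_∈ tests) ps →
      suc ω * ∑ ps (λ AS → ∑ (offers n) (λ o → [ misses? o AS ]ᵈ)) ≤ length ps * (ω * N)
    bound []       = ≤-reflexive (*-zeroʳ (suc ω))
    bound {AS ∷ _} (p ∷ ps) = ≤-trans (≤-reflexive (*-distribˡ-+ (suc ω) (∑ (offers n) (λ o → [ misses? o AS ]ᵈ)) _)) (+-mono-≤ (misses-bound p) (bound ps))

  step₂ : ∀ {E} (s : Testing E) → Mixing E ⊎ ((1 ≤ length (pending s)) ×
    (Σ[ f ∈ (∀ o → Σ[ c ∈ Maybe (Choice o) ] Testing (extend E o c)) ]
      (suc ω * ∑ (offers n) (λ o → length (pending (proj₂ (f o)))) ≤ ω * (N * length (pending s)))))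
  step₂ s@(testing []      _ passed) = inj₁ λ AS∈ → case passed AS∈ of λ { (inj₂ j) → j }
  step₂ s@(testing (_ ∷ _) _ _)      = inj₂ (s≤s z≤n , retest s , retest-drift s)

  -- There are at most `4 ^ n` tests, and every `ω` rounds halve the chance that a test survives.
  -- After `3 * n` halvings the expected number of survivors is at most `1 / 2 ^ n`, hence at most
  -- `1 / n`.
  phase₂ : ∀ {E} → k ≤ n → length F ≤ n → 1 ≤ ω → Wins Mixing (ω * (3 * n)) E 1
  phase₂ {E} k≤n F≤n 1≤ω = wins (run T s₀) (begin
      b * n              ≤⟨ *-monoʳ-≤ b (n≤2^n n) ⟩
      b * 2 ^ n          ≤⟨ *-cancelʳ-≤ _ _ (2 ^ n * 2 ^ n * ω ^ T) {{>-nonZero positive}} main ⟩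
      N ^ T              ≡⟨ sym (+-identityʳ _) ⟩
      1 * N ^ T          ∎)
    where
    open ≤-Reasoning
    open Potential Mixing Testing (λ s → length (pending s)) ω 1 step₂
    T = ω * (3 * n)
    s₀ : Testing E
    s₀ = testing tests (All.tabulate id) inj₁
    b = bad T (run T s₀)
    positive : 1 ≤ 2 ^ n * 2 ^ n * ω ^ T
    positive = *-mono-≤ {1} {2 ^ n * 2 ^ n} (*-mono-≤ {1} {2 ^ n} {1} {2 ^ n} (^-positive 1 n) (^-positive 1 n))
      (≤-trans (≤-reflexive (sym (^-zeroˡ T))) (^-monoˡ-≤ T 1≤ω))
    doubling : 2 * ω ^ ω ≤ suc ω ^ ω
    doubling = *-cancelˡ-≤ ω {{>-nonZero 1≤ω}} (≤-trans (≤-reflexive (lem ω (ω ^ ω))) (bernoulli ω ω))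
      where
      lem : ∀ w x → w * (2 * x) ≡ x * (w + w)
      lem w x = solve (w ∙ x ∙ ε)
    decay : 2 ^ n * (2 ^ n * 2 ^ n) * ω ^ T ≤ suc ω ^ T
    decay = begin
      2 ^ n * (2 ^ n * 2 ^ n) * ω ^ T
        ≡⟨ cong₂ _*_ (trans (cong (2 ^ n *_) (sym (^-distribˡ-+-* 2 n n))) (trans (sym (^-distribˡ-+-* 2 n (n + n)))
             (cong (λ m → 2 ^ (n + (n + m))) (sym (+-identityʳ n))))) (sym (^-*-assoc ω ω (3 * n))) ⟩
      2 ^ (3 * n) * (ω ^ ω) ^ (3 * n)
        ≡⟨ ^-*-distrib 2 (ω ^ ω) (3 * n) ⟩
      (2 * ω ^ ω) ^ (3 * n)
        ≤⟨ ^-monoˡ-≤ (3 * n) doubling ⟩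
      (suc ω ^ ω) ^ (3 * n)
        ≡⟨ ^-*-assoc (suc ω) ω (3 * n) ⟩
      suc ω ^ T ∎
    few : length tests ≤ 2 ^ n * 2 ^ n
    few = ≤-trans (length-filter large? (cartesianProduct (sublists (allFin k)) (sublists F)))
      (≤-trans (≤-reflexive (length-cartesianProduct (sublists (allFin k)) (sublists F)))
        (*-mono-≤ (≤-trans (≤-reflexive (length-sublists (allFin k))) (^-monoʳ-≤ 2 (≤-trans (≤-reflexive (length-tabulate {n = k} id)) k≤n)))
                  (≤-trans (≤-reflexive (length-sublists F)) (^-monoʳ-≤ 2 F≤n))))
    main : b * 2 ^ n * (2 ^ n * 2 ^ n * ω ^ T) ≤ N ^ T * (2 ^ n * 2 ^ n * ω ^ T)
    main = begin
      b * 2 ^ n * (2 ^ n * 2 ^ n * ω ^ T)      ≡⟨ lem b (2 ^ n) (ω ^ T) ⟩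
      1 * b * (2 ^ n * (2 ^ n * 2 ^ n) * ω ^ T) ≤⟨ *-monoʳ-≤ (1 * b) decay ⟩
      1 * b * suc ω ^ T                        ≤⟨ bad-run T s₀ ⟩
      length tests * (ω ^ T * N ^ T)           ≤⟨ *-monoˡ-≤ _ few ⟩
      2 ^ n * 2 ^ n * (ω ^ T * N ^ T)          ≡⟨ lem′ (2 ^ n) (ω ^ T) (N ^ T) ⟩
      N ^ T * (2 ^ n * 2 ^ n * ω ^ T)          ∎
      where
      lem : ∀ b x y → b * x * (x * x * y) ≡ 1 * b * (x * (x * x) * y)
      lem b x y = solve (b ∙ x ∙ y ∙ ε)
      lem′ : ∀ x y z → x * x * (y * z) ≡ z * (x * x * y)
      lem′ x y z = solve (x ∙ y ∙ z ∙ ε)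

-- Expansion and alternating paths

argmax : {A : Set} (f : A → ℕ) (xs : List A) {x : A} → x ∈ xs → Σ[ b ∈ A ] (b ∈ xs × (∀ {y} → y ∈ xs → f y ≤ f b))
argmax f (x ∷ [])         _ = x , here refl , λ { (here refl) → ≤-refl }
argmax f (x ∷ xs@(y ∷ _)) _ with argmax f xs (here refl)
... | b , b∈ , max with ≤-total (f x) (f b)
...   | inj₁ fx≤fb = b , there b∈ , λ { (here refl) → fx≤fb ; (there z∈) → max z∈ }
...   | inj₂ fb≤fx = x , here refl , λ { (here refl) → ≤-refl ; (there z∈) → ≤-trans (max z∈) fb≤fx }

length-filter-split : {A : Set} {P : A → Set} (P? : Decidable P) (xs : List A) →
  length xs ≡ length (filter P? xs) + length (filter (λ x → ¬? (P? x)) xs)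
length-filter-split P? [] = refl
length-filter-split P? (x ∷ xs) with P? x
... | yes _ = cong suc (length-filter-split P? xs)
... | no _  = trans (cong suc (length-filter-split P? xs)) (sym (+-suc _ _))

[]∈sublists : {A : Set} (xs : List A) → [] ∈ sublists xs
[]∈sublists []       = here refl
[]∈sublists (x ∷ xs) = ∈-++⁺ʳ (map (x ∷_) (sublists xs)) ([]∈sublists xs)

_∈ᵛ?_ : ∀ {n} (x : Fin n) xs → Dec (x ∈ xs)
x ∈ᵛ? xs = any? (x Fin.≟_) xs

_∈ᵉ?_ : ∀ {n} (e : Subset n) (E : Edges n) → Dec (e ∈ E)
e ∈ᵉ? E = any? (Vec.≡-dec Bool._≟_ e) E

-- The condition that everything fitting `i` is good keeps exchanges among good fillers: what such a
-- gadget releases can be exchanged further.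
Expanding : ∀ {n k} → (Fin k → Fin n → Set) → (Fin n → Set) → ℕ → Set
Expanding {n} {k} Fit Good m = ∀ S → Unique S → All Good S → length S ≤ m → Σ[ I ∈ List (Fin k) ]
  (Unique I × length S ≤ length I × All (λ i → (∀ {f} → Fit i f → Good f) × Any (Fit i) S) I)

module Expansion (n g ω : ℕ) (ω-large : 2 * (n * n) ≤ ω * (g * g))
  {k : ℕ} (xs : Vec (Fin n) (suc k)) (F : List (Fin n)) (all : toList xs ++ F ↭ allFin n)
  (4g≤k : 4 * g ≤ k) (E : Edges n) where

  open Fillers n g ω ω-large xs F all

  Fit : Fin k → Fin n → Set
  Fit i f = (f ∈ F) × Fill E i f

  fit? : ∀ i f → Dec (Fit i f)
  fit? i f = (f ∈F?) ×-dec (triple (left xs i) f (right xs i) ∈ᵉ? E)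

  touches? : ∀ S i → Dec (Any (Fit i) S)
  touches? S i = any? (fit? i) S

  untouched : List (Fin n) → List (Fin k)
  untouched S = filter (λ i → ¬? (touches? S i)) (allFin k)

  -- Up to the constant `k` this is the deficiency of Hall's theorem, the size of `S` minus the
  -- number of gadgets it touches.
  score : List (Fin n) → ℕ
  score S = length S + length (untouched S)

  candidates : List (List (Fin n))
  candidates = filter (λ S → length S ≤? 3 * g) (sublists F)

  module _ (mixing : Mixing E) where

    -- Adding a small set that fails to expand to a maximiser would increase the score further.
    private
      extremal : Σ[ B ∈ List (Fin n) ] (B ∈ candidates × (∀ {S} → S ∈ candidates → score S ≤ score B))
      extremal = argmax score candidates (∈-filter⁺ (λ S → length S ≤? 3 * g) ([]∈sublists F) z≤n)

    poor : List (Fin n)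
    poor = proj₁ extremal

    private
      B = poor

      B∈ : B ∈ sublists F × length B ≤ 3 * g
      B∈ = ∈-filter⁻ (λ S → length S ≤? 3 * g) {xs = sublists F} (proj₁ (proj₂ extremal))

    poor⊆ : ∀ {f} → f ∈ poor → f ∈ F
    poor⊆ = sublists-⊆ F (proj₁ B∈)

    unique-poor : Unique poor
    unique-poor = unique-sublists unique-F (proj₁ B∈)

    private
      untouched-small : g ≤ length B → length (untouched B) < g
      untouched-small g≤B = ≰⇒> λ g≤U → case mixing {untouched B , B} (∈-filter⁺ large?
          (∈-cartesianProduct⁺ (filter∈sublists _ (allFin k)) (proj₁ B∈)) (g≤U , g≤B)) of λ where
        (i , f , i∈ , f∈ , e) → proj₂ (∈-filter⁻ (λ i → ¬? (touches? B i)) {xs = allFin k} i∈) (lose f∈ (poor⊆ f∈ , e))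

    -- With `g` or more elements, mixing would leave fewer than `g` gadgets untouched, and the score
    -- would fall below `3 * g + g ≤ k`, which the empty set attains.
    poor-few : length poor < g
    poor-few = ≰⇒> λ g≤B → <⇒≱ (begin-strict
        score B               <⟨ +-mono-≤-< (proj₂ B∈) (untouched-small g≤B) ⟩
        3 * g + g             ≡⟨ +-comm (3 * g) g ⟩
        4 * g                 ≤⟨ 4g≤k ⟩
        k                     ≡⟨ sym (length-tabulate {n = k} id) ⟩
        length (allFin k)     ≡⟨ cong length (sym (filter-all (λ i → ¬? (touches? [] i)) (All.tabulate {xs = allFin k} λ _ ()))) ⟩
        score []              ∎)
      (proj₂ (proj₂ extremal) (∈-filter⁺ (λ S → length S ≤? 3 * g) ([]∈sublists F) z≤n))
      where open ≤-Reasoning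

    Good : Fin n → Set
    Good f = (f ∈ F) × (f ∉ poor)

    -- `S` and `poor` together have at most `2 * g + g` elements, which is why candidates are capped
    -- at `3 * g`. Maximality of `poor` then forces `S` to touch at least `length S` gadgets that
    -- `poor` does not touch, and whatever fits these is good.
    expanding : Expanding Fit Good (2 * g)
    expanding S uS goodS S≤ = I , Unique.filter⁺ (touches? S) (Unique.filter⁺ _ (Unique.allFin⁺ k)) ,
        +-cancelʳ-≤ (length (untouched T)) _ _ (begin
          length S + length (untouched T)  ≤⟨ +-cancelʳ-≤ (length B) _ _ shrink ⟩
          length (untouched B)             ≡⟨ length-filter-split (touches? S) (untouched B) ⟩
          length I + length (filter (λ i → ¬? (touches? S i)) (untouched B)) ≤⟨ +-monoʳ-≤ (length I) rest≤ ⟩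
          length I + length (untouched T)  ∎) ,
        All.tabulate touching
      where
      open ≤-Reasoning
      SB = S ++ B
      -- `T` is `SB` in the order of `F`, as candidates must be sublists of `F`.
      T = filter (_∈ᵛ? SB) F
      I = filter (touches? S) (untouched B)
      uSB : Unique SB
      uSB = Unique.++⁺ uS unique-poor λ { (x∈S , x∈B) → proj₂ (All.lookup goodS x∈S) x∈B }
      SB⊆F : ∀ {f} → f ∈ SB → f ∈ F
      SB⊆F f∈ = [ proj₁ ∘ All.lookup goodS , poor⊆ ]′ (∈-++⁻ S f∈)
      SB⊆T : ∀ {f} → f ∈ SB → f ∈ T
      SB⊆T f∈ = ∈-filter⁺ (_∈ᵛ? SB) (SB⊆F f∈) f∈
      T⊆SB : ∀ {f} → f ∈ T → f ∈ SB
      T⊆SB f∈ = proj₂ (∈-filter⁻ (_∈ᵛ? SB) {xs = F} f∈)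
      T-small : length T ≤ 3 * g
      T-small = begin
        length T             ≤⟨ unique-length-≤ (Unique.filter⁺ (_∈ᵛ? SB) unique-F) T⊆SB ⟩
        length SB            ≡⟨ length-++ S ⟩
        length S + length B  ≤⟨ +-mono-≤ S≤ (<⇒≤ poor-few) ⟩
        2 * g + g            ≡⟨ +-comm (2 * g) g ⟩
        3 * g                ∎
      shrink : length S + length (untouched T) + length B ≤ length (untouched B) + length B
      shrink = begin
        length S + length (untouched T) + length B  ≡⟨ lem (length S) (length (untouched T)) (length B) ⟩
        length S + length B + length (untouched T)  ≡⟨ cong (_+ length (untouched T)) (sym (length-++ S)) ⟩
        length SB + length (untouched T)            ≤⟨ +-monoˡ-≤ _ (unique-length-≤ uSB SB⊆T) ⟩
        score T                                     ≤⟨ proj₂ (proj₂ extremal) (∈-filter⁺ (λ S → length S ≤? 3 * g) (filter∈sublists (_∈ᵛ? SB) F) T-small) ⟩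
        score B                                     ≡⟨ +-comm (length B) _ ⟩
        length (untouched B) + length B             ∎
        where
        lem : ∀ a b c → a + b + c ≡ a + c + b
        lem a b c = solve (a ∙ b ∙ c ∙ ε)
      rest≤ : length (filter (λ i → ¬? (touches? S i)) (untouched B)) ≤ length (untouched T)
      rest≤ = unique-length-≤ (Unique.filter⁺ _ (Unique.filter⁺ _ (Unique.allFin⁺ k))) λ {i} i∈ →
        case ∈-filter⁻ (λ i → ¬? (touches? S i)) {xs = untouched B} i∈ of λ where
          (i∈U , ¬S) → case ∈-filter⁻ (λ i → ¬? (touches? B i)) {xs = allFin k} i∈U of λ where
            (i∈k , ¬B) → ∈-filter⁺ (λ i → ¬? (touches? T i)) i∈k λ t → case find t of λ where
              (f , f∈ , fit) → [ (λ f∈S → ¬S (lose f∈S fit)) , (λ f∈B → ¬B (lose f∈B fit)) ]′ (∈-++⁻ S (T⊆SB f∈))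
      touching : ∀ {i} → i ∈ I → (∀ {f} → Fit i f → Good f) × Any (Fit i) S
      touching i∈ with ∈-filter⁻ (touches? S) {xs = untouched B} i∈
      ... | i∈U , t = (λ fit → proj₁ fit , λ f∈B →
        proj₂ (∈-filter⁻ (λ i → ¬? (touches? B i)) {xs = allFin k} i∈U) (lose f∈B fit)) , t

update-↭ : ∀ {A : Set} {k} (M : Vec A k) i a L → toList (M [ i ]≔ a) ++ lookup M i ∷ L ↭ toList M ++ a ∷ L
update-↭ (x ∷ M) zero    a L = ↭-trans (prep a (shift x (toList M) L))
  (↭-trans (swap a x ↭-refl) (prep x (↭-sym (shift a (toList M) L))))
update-↭ (x ∷ M) (suc i) a L = prep x (update-↭ M i a L)

module Engine {n k m : ℕ} {Fit : Fin k → Fin n → Set} {Good : Fin n → Set} (expanding : Expanding Fit Good m) where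

  Matching : Vec (Fin n) k → Set
  Matching M = ∀ i → Fit i (lookup M i)

  Exchange : Vec (Fin n) k → Fin n → Fin n → List (Fin n) → Set
  Exchange M w a L = Good a × (Σ[ M′ ∈ Vec (Fin n) k ] (Matching M′ × (toList M′ ++ a ∷ L ↭ toList M ++ w ∷ L)))

  module _ (M : Vec (Fin n) k) (matching : Matching M) (w : Fin n) (L : List (Fin n)) (good-w : Good w)
    (u : Unique (toList M ++ w ∷ L)) where

    private
      -- The agreement clause says that a gadget whose filler is not yet reached still holds it, so
      -- that one more exchange can release it.
      Alternating : List (Fin n) → Fin n → Set
      Alternating S a = Good a × (Σ[ M′ ∈ Vec (Fin n) k ] (Matching M′ × (toList M′ ++ a ∷ L ↭ toList M ++ w ∷ L) ×
        (∀ i → lookup M i ∉ S → lookup M′ i ≡ lookup M i)))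

      Reached : ℕ → Set
      Reached j = Σ[ S ∈ List (Fin n) ] (length S ≡ j × Unique (w ∷ S) × All (Alternating (w ∷ S)) (w ∷ S))

      M-injective : ∀ {i j} → lookup M i ≡ lookup M j → i ≡ j
      M-injective = lookup-injective M (unique-++ˡ (toList M) u)

      M≢w : ∀ i → lookup M i ≢ w
      M≢w i = unique-disjoint (toList M) u (lookup∈ M i) (here refl)

      -- The `j + 1` vertices reached touch more gadgets than `S` has elements, and `w` fills none
      -- of them, so some touched gadget holds a new filler `b`. Freeing the vertex `a` that fits
      -- there and then putting `a` in place of `b` frees `b`.
      grow : ∀ {j} → suc j ≤ m → Reached j → Reached (suc j)
      grow {j} j<m (S , refl , uS , alts) = next (any? (λ i → ¬? (lookup M i ∈ᵛ? (w ∷ S))) I)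
        where
        expansion = expanding (w ∷ S) uS (All.map proj₁ alts) j<m
        I = proj₁ expansion
        next : Dec (Any (λ i → lookup M i ∉ w ∷ S) I) → Reached (suc j)
        next (no all∈) = ⊥-elim (<⇒≱ (proj₁ (proj₂ (proj₂ expansion))) (≤-trans
            (≤-reflexive (sym (length-map (lookup M) I)))
            (unique-length-≤ (Unique.map⁺ M-injective (proj₁ (proj₂ expansion))) λ x∈ → case ∈-map⁻ (lookup M) x∈ of λ where
              (i , i∈ , refl) → case lookup M i ∈ᵛ? (w ∷ S) of λ where
                (yes (here eq))  → ⊥-elim (M≢w i eq)
                (yes (there p))  → p
                (no ¬p)          → ⊥-elim (all∈ (lose i∈ ¬p)))))
        next (yes some) with find some
        ... | i , i∈ , Mi∉ with All.lookup (proj₂ (proj₂ (proj₂ expansion))) i∈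
        ...   | closed , touch with find touch
        ...     | a , a∈ , fit with All.lookup alts a∈
        ...       | _ , M′ , matching′ , perm , agree = b ∷ S , refl ,
            unique-↭ (swap b w ↭-refl) (All.tabulate (λ x∈ eq → Mi∉ (subst (_∈ w ∷ S) (sym eq) x∈)) ∷ uS) ,
            weaken-alt (All.head alts) ∷ (closed (matching i) , M″ , matching″ , perm″ , agree″) ∷ All.map weaken-alt (All.tail alts)
          where
          b = lookup M i
          M″ = M′ [ i ]≔ a
          M′i : lookup M′ i ≡ b
          M′i = agree i Mi∉
          ∉-weaken : ∀ {x} → x ∉ w ∷ b ∷ S → x ∉ w ∷ S
          ∉-weaken x∉ (here eq) = x∉ (here eq)
          ∉-weaken x∉ (there p) = x∉ (there (there p))
          weaken-alt : ∀ {x} → Alternating (w ∷ S) x → Alternating (w ∷ b ∷ S) x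
          weaken-alt (good , N , matchingN , permN , agreeN) = good , N , matchingN , permN , λ i p → agreeN i (∉-weaken p)
          matching″ : Matching M″
          matching″ j with i Fin.≟ j
          ... | yes refl = subst (Fit i) (sym (Vec.lookup∘update i M′ a)) fit
          ... | no i≢j   = subst (Fit j) (sym (Vec.lookup∘update′ (i≢j ∘ sym) M′ a)) (matching′ j)
          perm″ : toList M″ ++ b ∷ L ↭ toList M ++ w ∷ L
          perm″ = ↭-trans (subst (λ x → toList M″ ++ x ∷ L ↭ toList M′ ++ a ∷ L) M′i (update-↭ M′ i a L)) perm
          agree″ : ∀ j → lookup M j ∉ w ∷ b ∷ S → lookup M″ j ≡ lookup M j
          agree″ j p with i Fin.≟ j
          ... | yes refl = ⊥-elim (p (there (here refl)))
          ... | no i≢j   = trans (Vec.lookup∘update′ (i≢j ∘ sym) M′ a) (agree j (∉-weaken p))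

      reached : ∀ j → j ≤ m → Reached j
      reached zero    _   = [] , refl , [] ∷ [] , (good-w , M , matching , ↭-refl , λ _ _ → refl) ∷ []
      reached (suc j) j<m = grow j<m (reached j (<⇒≤ j<m))

    -- The new fillings only rearrange vertices among gadgets they already fit, so no round is spent
    -- on an exchange.
    exchangeable : Σ[ S ∈ List (Fin n) ] (Unique S × m ≤ length S × All (λ a → Exchange M w a L) S)
    exchangeable with reached m ≤-refl
    ... | S , eq , uS , alts = w ∷ S , uS , ≤-trans (≤-reflexive (sym eq)) (n≤1+n _) ,
      All.map (λ { (good , M′ , matching′ , perm , _) → good , M′ , matching′ , perm }) alts

-- The counterpart of `splitPairs` for successive exchanges, where the choices for the second entry
-- depend on the first.
dependentPairs : ∀ {A : Set} {m} {R : A → A → Set} {S : List A} → Unique S →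
  All (λ a → Σ[ T ∈ List A ] (Unique T × m ≤ length T × All (λ b → a ≢ b × R a b) T)) S →
  Σ[ P ∈ Pairs (length S * m) R ] All (λ p → proj₁ p ∈ S) (Pairs.pairs P)
dependentPairs [] [] = mkPairs [] [] [] z≤n (λ ()) , []
dependentPairs {R = R} {S = a ∷ S} (a∉ ∷ u) ((T , uT , m≤ , rs) ∷ ts) with dependentPairs u ts
... | mkPairs ps ups prps size sound , firsts = mkPairs (map (a ,_) T ++ ps)
    (Unique.++⁺ (Unique.map⁺ (λ { refl → refl }) uT) ups λ { (p∈ , q∈) → case ∈-map⁻ (a ,_) p∈ of λ where
      (_ , _ , refl) → All.lookup a∉ (All.lookup firsts q∈) refl })
    (All.++⁺ (All.map⁺ (All.map proj₁ rs)) prps)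
    (≤-trans (+-mono-≤ m≤ size) (≤-reflexive (sym (trans (length-++ (map (a ,_) T)) (cong (_+ length ps) (length-map (a ,_) T))))))
    (λ p∈ → [ (λ q∈ → case ∈-map⁻ (a ,_) q∈ of λ { (b , b∈ , refl) → proj₂ (All.lookup rs b∈) }) , sound ]′ (∈-++⁻ (map (a ,_) T) p∈)) ,
  All.++⁺ (All.map⁺ (All.tabulate (λ _ → here refl))) (All.map there firsts)

-- Absorbing the poor vertices

-- A vertex w still to be absorbed, with the pairs (t , f) for which {t, f, w} is an edge.
Coloured : ℕ → Set
Coloured n = Fin n × List (Fin n × Fin n)

colours : ∀ {n} → List (Coloured n) → List (Fin n × Fin n)
colours = concatMap proj₂

colours-↭ : ∀ {n} {K K′ : List (Coloured n)} → K ↭ K′ → colours K ↭ colours K′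
colours-↭ _↭_.refl          = ↭-refl
colours-↭ (prep (_ , cs) p) = ++⁺ˡ cs (colours-↭ p)
colours-↭ (swap (_ , cs) (_ , ds) p) = ↭-trans (shifts cs ds) (++⁺ˡ ds (++⁺ˡ cs (colours-↭ p)))
colours-↭ (_↭_.trans p r)   = ↭-trans (colours-↭ p) (colours-↭ r)

colours-≤ : ∀ {n} c (K : List (Coloured n)) → All (λ wc → length (proj₂ wc) ≤ c) K → length (colours K) ≤ length K * c
colours-≤ c []             []       = z≤n
colours-≤ c ((_ , cs) ∷ K) (p ∷ ps) = ≤-trans (≤-reflexive (length-++ cs)) (+-mono-≤ p (colours-≤ c K ps))

colours-≥ : ∀ {n} c (K : List (Coloured n)) → All (λ wc → c ≤ length (proj₂ wc)) K → length K * c ≤ length (colours K)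
colours-≥ c []             []       = z≤n
colours-≥ c ((_ , cs) ∷ K) (p ∷ ps) = ≤-trans (+-mono-≤ p (colours-≥ c K ps)) (≤-reflexive (sym (length-++ cs)))

module Absorption (n g ω : ℕ) (1≤g : 1 ≤ g) (100g≤n : 100 * g ≤ n) (n≤200g : n ≤ 200 * g)
  (ω-large : 2 * (n * n) ≤ ω * (g * g)) (Good : Fin n → Set) (x₀ : Fin n) (base : List (Fin n)) (unique-base : Unique base) where

  open Scale n
  open Phases n g ω 1≤g 100g≤n ω-large using (enough-pairs; n≢0)
  open ++-Solver {n} using (_⊕_; _⊜_) renaming (solve to solve-↭)

  -- A colour costs ω and a link with κ vertices left costs ω q κ; colours in stock count as prepaid.
  Y : ℕ → ℕ
  Y κ = 8 * ω * (κ + s κ)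

  -- `reserve` counts the good vertices outside the path, two for each colour. A link uses three of
  -- them, `t`, `f` and `b`, and the other colours of `w` return to `R`, so the coefficient 3 keeps
  -- the inequality exact.
  record Absorbing (K : List (Coloured n)) (W : ℕ) (E : Edges n) : Set where
    constructor absorbing
    field
      h       : Fin n
      tail    : List (Fin n)
      path    : Path E h tail x₀
      R       : List (Fin n)
      covers  : h ∷ tail ++ R ++ map proj₁ K ++ map proj₁ (colours K) ++ map proj₂ (colours K) ↭ base
      good-R  : All Good R
      good-t  : All (Good ∘ proj₁) (colours K)
      good-f  : All (Good ∘ proj₂) (colours K)
      few     : length K ≤ g
      capped  : All (λ wc → length (proj₂ wc) ≤ q (length K)) K
      edge    : All (λ wc → All (λ tf → triple (proj₁ tf) (proj₂ tf) (proj₁ wc) ∈ E) (proj₂ wc)) K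
      budget  : Y (length K) ≤ W + ω * length (colours K)
      reserve : 34 * g + 3 * length K ≤ length R + 2 * length (colours K)

  AbsorbingAny : ℕ → Edges n → Set
  AbsorbingAny W E = Σ[ K ∈ List (Coloured n) ] Absorbing K W E

  record Absorbed (E : Edges n) : Set where
    constructor absorbed
    field
      h      : Fin n
      tail   : List (Fin n)
      path   : Path E h tail x₀
      R      : List (Fin n)
      covers : h ∷ tail ++ R ↭ base
      good-R : All Good R
      plenty : 3 ≤ length R

  permute : ∀ {K K′ W E} → K ↭ K′ → Absorbing K W E → Absorbing K′ W E
  permute {K} {K′} {W} p (absorbing h tail path R covers gR gt gf few capped edge budget reserve) =
    absorbing h tail path R
      (↭-trans (prep h (++⁺ˡ tail (++⁺ˡ R (++⁺ (map⁺ proj₁ (↭-sym p)) (++⁺ (map⁺ proj₁ (↭-sym (colours-↭ p))) (map⁺ proj₂ (↭-sym (colours-↭ p)))))))) covers)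
      gR (All-resp-↭ (colours-↭ p) gt) (All-resp-↭ (colours-↭ p) gf)
      (subst (_≤ g) κ≡ few) (All-resp-↭ p (subst (λ κ → All (λ wc → length (proj₂ wc) ≤ q κ) K) κ≡ capped)) (All-resp-↭ p edge)
      (subst₂ (λ κ x → Y κ ≤ W + ω * x) κ≡ x≡ budget) (subst₂ (λ κ x → 34 * g + 3 * κ ≤ length R + 2 * x) κ≡ x≡ reserve)
    where
    κ≡ = ↭-length p
    x≡ = ↭-length (colours-↭ p)

  -- `κ * n` is at most `200 * g * g`, and `15 * 15` is the first square above 200.
  s≤15g : ∀ {κ} → κ ≤ g → s κ ≤ 15 * g
  s≤15g {κ} κ≤g = s-least {κ} (≤-trans (*-mono-≤ κ≤g n≤200g) (≤-trans (m≤m+n _ (25 * (g * g))) (≤-reflexive (lem g))))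
    where
    lem : ∀ g → g * (200 * g) + 25 * (g * g) ≡ 15 * g * (15 * g)
    lem g = solve (g ∙ ε)

  κq≤κ+s : ∀ κ → κ * q κ ≤ κ + s κ
  κq≤κ+s zero    = z≤n
  κq≤κ+s (suc κ) = κq≤ κ

  module _ {K W E} (a : Absorbing K W E) where
    open Absorbing a

    -- The stock has at most `κ + s κ`, hence `16 * g`, colours and binds at most `32 * g` vertices;
    -- the 34 in `reserve` leaves `2 * g` of them in `R`.
    2g≤R : 2 * g ≤ length R
    2g≤R = lin (3 * length K) (+-mono-≤ reserve (*-monoʳ-≤ 2 (≤-trans (≤-trans (colours-≤ _ K capped) (κq≤κ+s (length K)))
        (+-mono-≤ few (s≤15g few)))))
      (lem g (length R) (length (colours K)) (length K))
      where
      lem : ∀ g r x κ → 2 * g + (r + 2 * x + 2 * (g + 15 * g)) + 3 * κ ≡ r + (34 * g + 3 * κ + 2 * x)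
      lem g r x κ = solve (g ∙ r ∙ x ∙ κ ∙ ε)

    unique-parts : Unique (h ∷ tail ++ R ++ map proj₁ K ++ map proj₁ (colours K) ++ map proj₂ (colours K))
    unique-parts = unique-↭ (↭-sym covers) unique-base

    unique-R⁺ : Unique (R ++ map proj₁ K ++ map proj₁ (colours K) ++ map proj₂ (colours K))
    unique-R⁺ = unique-++ʳ (h ∷ tail) unique-parts

    head≢ : ∀ {x} → x ∈ R ++ map proj₁ K ++ map proj₁ (colours K) ++ map proj₂ (colours K) → h ≢ x
    head≢ x∈ = unique-disjoint (h ∷ tail) unique-parts (here refl) x∈

  -- A single link may gain as much as `ω * q 1`, about `ω√n`. The failure probability `d / n` of
  -- this stage is thus of order `1/√n`, the worst of all stages.
  d : ℕ
  d = suc (ω * q 1)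

  q-bound : ∀ κ → ω * q (suc κ) ≤ suc d
  q-bound κ = ≤-trans (*-monoʳ-≤ ω (q-antitone {1} {suc κ} (s≤s z≤n))) (m≤n+m _ 2)

  ω≤d : ω ≤ suc d
  ω≤d = ≤-trans (≤-trans (≤-reflexive (sym (*-identityʳ ω))) (*-monoʳ-≤ ω 1≤q)) (m≤n+m _ 2)
    where
    1≤q : 1 ≤ q 1
    1≤q with q 1 | n≤κq² 0
    ... | suc _ | _ = s≤s z≤n
    ... | zero  | p = ⊥-elim (n≢0 (n≤0⇒n≡0 p))

  colour : ∀ {w cs K W E} → Absorbing ((w , cs) ∷ K) W E → length cs < q (suc (length K)) → Progress AbsorbingAny d W E
  colour {w} {cs} {K} {W} {E} A@(absorbing h tail path R covers gR gt gf few (_ ∷ capped) (ew ∷ edge) budget reserve) cs<q =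
    advance ω (W ∸ ω) ω≤d (≤-reflexive (m∸n+n≡m ω≤W)) (enough-pairs ≤-refl)
      (splitPairs g R (unique-++ˡ R (unique-R⁺ A)) (2g≤R A)) respond
    where
    κ = suc (length K)
    x = length (colours ((w , cs) ∷ K))
    x<κq : suc x ≤ κ * q κ
    x<κq = ≤-trans (≤-reflexive (cong suc (length-++ cs))) (+-mono-≤ cs<q (colours-≤ (q κ) K capped))
    ωx≤Y : ω * suc x ≤ Y κ
    ωx≤Y = ≤-trans (*-monoʳ-≤ ω (≤-trans x<κq (κq≤κ+s κ))) (*-monoˡ-≤ (κ + s κ) (m≤n*m ω 8))
    -- The truncated `W ∸ ω` has to be a true difference: even with one more colour the stock is
    -- worth at most `ω * (κ * q κ)`, hence at most `Y κ`.
    ω≤W : ω ≤ W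
    ω≤W = +-cancelʳ-≤ (ω * x) _ _ (≤-trans (≤-reflexive (sym (*-suc ω x))) (≤-trans ωx≤Y budget))
    respond : ∀ {a b} → Σ[ R′ ∈ List (Fin n) ] (R ↭ a ∷ b ∷ R′) →
      Σ[ c ∈ Fin n ] ((c ≢ a) × (c ≢ b) × AbsorbingAny (W ∸ ω) (triple a b c ∷ E))
    respond {a} {b} (R′ , R↭) = w , w≢ (here refl) , w≢ (there (here refl)) , (w , (a , b) ∷ cs) ∷ K ,
      absorbing h tail (Path-⊆ there path) R′ covers′ (All.tail (All.tail good-ab)) (All.head good-ab ∷ gt) (All.head (All.tail good-ab) ∷ gf)
        few (cs<q ∷ capped) ((here refl ∷ All.map there ew) ∷ All.map (All.map there) edge) budget′ reserve′
      where
      w≢ : ∀ {y} → y ∈ a ∷ b ∷ R′ → w ≢ y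
      w≢ y∈ eq = unique-disjoint R (unique-R⁺ A) (∈-resp-↭ (↭-sym R↭) y∈) (here refl) (sym eq)
      good-ab : All Good (a ∷ b ∷ R′)
      good-ab = All-resp-↭ R↭ gR
      ts = map proj₁ (colours ((w , cs) ∷ K))
      fs = map proj₂ (colours ((w , cs) ∷ K))
      covers′ : h ∷ tail ++ R′ ++ w ∷ map proj₁ K ++ (a ∷ ts) ++ (b ∷ fs) ↭ base
      covers′ = ↭-trans (prep h (++⁺ˡ tail (↭-trans
          (solve-↭ 6 (λ a b r w t f → (r ⊕ (w ⊕ ((a ⊕ t) ⊕ (b ⊕ f)))) ⊜ ((a ⊕ (b ⊕ r)) ⊕ (w ⊕ (t ⊕ f)))) ↭-refl
            [ a ] [ b ] R′ (w ∷ map proj₁ K) ts fs)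
          (++⁺ʳ (w ∷ map proj₁ K ++ ts ++ fs) (↭-sym R↭))))) covers
      budget′ : Y κ ≤ (W ∸ ω) + ω * suc x
      budget′ = ≤-trans budget (≤-reflexive (trans (cong (_+ ω * x) (sym (m∸n+n≡m ω≤W)))
        (trans (+-assoc (W ∸ ω) ω _) (cong (W ∸ ω +_) (sym (*-suc ω x))))))
      reserve′ : 34 * g + 3 * κ ≤ length R′ + 2 * suc x
      reserve′ = ≤-trans reserve (≤-reflexive (trans (cong (_+ 2 * x) (↭-length R↭)) (lem (length R′) x)))
        where
        lem : ∀ r x → suc (suc r) + 2 * x ≡ r + 2 * suc x
        lem r x = solve (r ∙ x ∙ ε)

  link : ∀ {t f w b cs K W W′ E} (A : Absorbing ((w , (t , f) ∷ cs) ∷ K) W E) → b ∈ Absorbing.R A →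
    Y (length K) ≤ W′ + ω * length (colours K) →
    (Absorbing.h A ≢ t) × (Absorbing.h A ≢ b) × AbsorbingAny W′ (triple t b (Absorbing.h A) ∷ E)
  link {t} {f} {w} {b} {cs} {K} {W} {W′} {E}
    A@(absorbing h tail path R covers gR (gt₀ ∷ gt) (gf₀ ∷ gf) few (cw ∷ capped) ((e ∷ _) ∷ edge) budget reserve) b∈ Y≤ =
    head≢ A (∈-++⁺ʳ R (∈-++⁺ʳ (w ∷ map proj₁ K) (here refl))) , head≢ A (∈-++⁺ˡ b∈) , K ,
    absorbing w (f ∷ t ∷ b ∷ h ∷ tail) (there (subst (_∈ E) (triple-rev t f w) e) ∷ here refl ∷ Path-⊆ there path) R′ covers′
      (All.++⁺ (All.tail good-bR) (All.++⁺ (All.map⁺ (All.++⁻ˡ cs gt)) (All.map⁺ (All.++⁻ˡ cs gf)))) (All.++⁻ʳ cs gt) (All.++⁻ʳ cs gf)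
      -- The cap on colours can only rise as fewer vertices are left.
      (<⇒≤ few) (All.map (λ p → ≤-trans p (q-antitone (n≤1+n (length K)))) capped) (All.map (All.map there) edge) Y≤ reserve′
    where
    R↭ : R ↭ b ∷ proj₁ (pick b∈)
    R↭ = proj₂ (pick b∈)
    R₁ = proj₁ (pick b∈)
    good-bR = All-resp-↭ R↭ gR
    T₁ = map proj₁ cs
    F₁ = map proj₂ cs
    R′ = R₁ ++ T₁ ++ F₁
    ts = map proj₁ (colours K)
    fs = map proj₂ (colours K)
    covers′ : w ∷ (f ∷ t ∷ b ∷ h ∷ tail) ++ R′ ++ map proj₁ K ++ ts ++ fs ↭ base
    covers′ = ↭-trans (solve-↭ 11 (λ w f t b h l r k T F tf → (w ⊕ (f ⊕ (t ⊕ (b ⊕ ((h ⊕ l) ⊕ ((r ⊕ (T ⊕ F)) ⊕ (k ⊕ tf)))))))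
          ⊜ ((h ⊕ l) ⊕ ((b ⊕ r) ⊕ ((w ⊕ k) ⊕ ((t ⊕ T) ⊕ ((f ⊕ F) ⊕ tf)))))) ↭-refl
          [ w ] [ f ] [ t ] [ b ] [ h ] tail R₁ (map proj₁ K) T₁ F₁ (ts ++ fs))
      (↭-trans (prep h (++⁺ˡ tail (++⁺ (↭-sym R↭) (prep w (++⁺ˡ (map proj₁ K) (↭-trans
          (solve-↭ 4 (λ T F a b → (T ⊕ (F ⊕ (a ⊕ b))) ⊜ ((T ⊕ a) ⊕ (F ⊕ b))) ↭-refl (t ∷ T₁) (f ∷ F₁) ts fs)
          (↭-reflexive (cong₂ _++_ (sym (map-++ proj₁ ((t , f) ∷ cs) (colours K))) (sym (map-++ proj₂ ((t , f) ∷ cs) (colours K))))))))))) covers)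
    reserve′ : 34 * g + 3 * length K ≤ length R′ + 2 * length (colours K)
    reserve′ = +-cancelʳ-≤ 3 _ _ (≤-trans (≤-reflexive (lem₁ g (length K))) (≤-trans reserve (≤-reflexive
        (trans (cong₂ (λ r x → r + 2 * suc x) (↭-length R↭) (length-++ cs))
          (trans (lem₂ (length R₁) (length cs) (length (colours K)))
            (cong (λ r → r + 2 * length (colours K) + 3) (sym (trans (length-++ R₁) (cong (length R₁ +_) (trans (length-++ T₁)
              (cong₂ _+_ (length-map proj₁ cs) (length-map proj₂ cs)))))))))) ))
      where
      lem₁ : ∀ g κ → 34 * g + 3 * κ + 3 ≡ 34 * g + 3 * suc κ
      lem₁ g κ = solve (g ∙ κ ∙ ε)
      lem₂ : ∀ r c x → suc r + 2 * suc (c + x) ≡ r + (c + c) + 2 * x + 3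
      lem₂ r c x = solve (r ∙ c ∙ x ∙ ε)

  recolour : ∀ {w cs ds K W E} → cs ↭ ds → Absorbing ((w , cs) ∷ K) W E → Absorbing ((w , ds) ∷ K) W E
  recolour {w} {cs} {ds} {K} {W} p (absorbing h tail path R covers gR gt gf few capped edge budget reserve) =
    absorbing h tail path R
      (↭-trans (prep h (++⁺ˡ tail (++⁺ˡ R (++⁺ˡ (w ∷ map proj₁ K) (++⁺ (map⁺ proj₁ (↭-sym p′)) (map⁺ proj₂ (↭-sym p′))))))) covers)
      gR (All-resp-↭ p′ gt) (All-resp-↭ p′ gf) few (subst (_≤ q (suc (length K))) (↭-length p) (All.head capped) ∷ All.tail capped)
      (All-resp-↭ p (All.head edge) ∷ All.tail edge)
      (subst (λ x → Y (suc (length K)) ≤ W + ω * x) x≡ budget) (subst (λ x → 34 * g + 3 * suc (length K) ≤ length R + 2 * x) x≡ reserve)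
    where
    p′ : cs ++ colours K ↭ ds ++ colours K
    p′ = ++⁺ʳ (colours K) p
    x≡ = ↭-length p′

  -- One copy of `ω * q` is the gain of the link; the other writes off the prepaid colours, at most
  -- `q` of them, of the linked vertex.
  Y-step : ∀ κ → Y κ + 2 * (ω * q (suc κ)) ≤ Y (suc κ)
  Y-step κ = lin 0 (*-monoʳ-≤ (2 * ω) (q≤Δs κ)) (lem ω κ (s κ) (s (suc κ)) (q (suc κ)))
    where
    lem : ∀ w κ s s′ q → 8 * w * (κ + s) + 2 * (w * q) + 2 * w * (4 + 4 * s′) + 0 ≡ 8 * w * (suc κ + s′) + 2 * w * (q + 4 * s)
    lem w κ s s′ q = solve (w ∙ κ ∙ s ∙ s′ ∙ q ∙ ε)

  -- With all vertices at the cap, the number of winning pairs is at least the number of vertices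
  -- times `q * g`. The gain `ω * q` is enough because the number of vertices times `q * q` is at
  -- least `n`; this is what fixes the size of `q`.
  linkAll : ∀ {κ K W E} → Absorbing K W E → length K ≡ suc κ → All (λ wc → q (suc κ) ≤ length (proj₂ wc)) K →
    Progress AbsorbingAny d W E
  linkAll {κ} {K} {W} {E} A K≡ full =
    advance (ω * q (suc κ)) (W ∸ ω * q (suc κ)) (q-bound κ) (≤-reflexive (m∸n+n≡m ωq≤W)) enough
      (mkPairs {R = λ t b → t ∈ ts × b ∈ R} (cartesianProduct ts R) (Unique.cartesianProduct⁺ unique-t (unique-++ˡ R (unique-R⁺ A)))
        (All.tabulate λ p∈ eq → unique-disjoint R (unique-R⁺ A) (proj₂ (∈-cartesianProduct⁻ ts R p∈))
          (∈-++⁺ʳ (map proj₁ K) (∈-++⁺ˡ (proj₁ (∈-cartesianProduct⁻ ts R p∈)))) (sym eq))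
        (≤-reflexive (sym (length-cartesianProduct ts R))) (∈-cartesianProduct⁻ ts R))
      respond
    where
    open Absorbing A
    open ≤-Reasoning
    Q = q (suc κ)
    ts = map proj₁ (colours K)
    unique-t : Unique ts
    unique-t = unique-++ˡ ts (unique-++ʳ (map proj₁ K) (unique-++ʳ R (unique-R⁺ A)))
    κQ≤x : suc κ * Q ≤ length ts
    κQ≤x = ≤-trans (≤-reflexive (cong (_* Q) (sym K≡))) (≤-trans (colours-≥ Q K full) (≤-reflexive (sym (length-map proj₁ (colours K)))))
    enough : 2 * (n * n) ≤ length ts * length R * (ω * Q)
    enough = begin
      2 * (n * n)                   ≤⟨ ω-large ⟩
      ω * (g * g)                   ≤⟨ *-monoʳ-≤ ω (*-monoˡ-≤ g (≤-trans (m≤n*m g 100) 100g≤n)) ⟩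
      ω * (n * g)                   ≤⟨ *-monoʳ-≤ ω (*-mono-≤ (n≤κq² κ) (≤-trans (m≤n*m g 2) (2g≤R A))) ⟩
      ω * (suc κ * (Q * Q) * length R) ≡⟨ lem ω κ Q (length R) ⟩
      suc κ * Q * length R * (ω * Q) ≤⟨ *-monoˡ-≤ (ω * Q) (*-monoˡ-≤ (length R) κQ≤x) ⟩
      length ts * length R * (ω * Q) ∎
      where
      lem : ∀ w κ q r → w * (suc κ * (q * q) * r) ≡ suc κ * q * r * (w * q)
      lem w κ q r = solve (w ∙ κ ∙ q ∙ r ∙ ε)
    ωq≤W : ω * Q ≤ W
    ωq≤W = +-cancelʳ-≤ (ω * (suc κ * Q)) _ _ (begin
      ω * Q + ω * (suc κ * Q)              ≡⟨ lem ω κ Q ⟩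
      ω * (κ * Q) + 2 * (ω * Q)            ≤⟨ +-monoˡ-≤ _ (≤-trans (*-monoʳ-≤ ω (≤-trans (*-monoʳ-≤ κ (q-antitone (n≤1+n κ))) (κq≤κ+s κ)))
                                                 (*-monoˡ-≤ (κ + s κ) (m≤n*m ω 8))) ⟩
      Y κ + 2 * (ω * Q)                    ≤⟨ Y-step κ ⟩
      Y (suc κ)                            ≡⟨ cong Y (sym K≡) ⟩
      Y (length K)                         ≤⟨ budget ⟩
      W + ω * length (colours K)           ≤⟨ +-monoʳ-≤ W (*-monoʳ-≤ ω (colours-≤ Q K (subst (λ κ → All (λ wc → length (proj₂ wc) ≤ q κ) K) K≡ capped))) ⟩
      W + ω * (length K * Q)               ≡⟨ cong (λ κ → W + ω * (κ * Q)) K≡ ⟩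
      W + ω * (suc κ * Q)                  ∎)
      where
      lem : ∀ w κ q → w * q + w * (suc κ * q) ≡ w * (κ * q) + 2 * (w * q)
      lem w κ q = solve (w ∙ κ ∙ q ∙ ε)
    finish : ∀ {t f w b cs K′} (A′ : Absorbing ((w , (t , f) ∷ cs) ∷ K′) W E) → length K′ ≡ κ → b ∈ Absorbing.R A′ →
      Σ[ c ∈ Fin n ] ((c ≢ t) × (c ≢ b) × AbsorbingAny (W ∸ ω * Q) (triple t b c ∷ E))
    finish {t} {f} {w} {b} {cs} {K′} A′@(absorbing _ _ _ _ _ _ _ _ _ (cw ∷ _) _ budget′ _) refl b∈ = _ , link A′ b∈ (+-cancelʳ-≤ (2 * (ω * Q)) _ _ (begin
      Y κ + 2 * (ω * Q)                                ≤⟨ Y-step κ ⟩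
      Y (suc κ)                                        ≤⟨ budget′ ⟩
      W + ω * length (((t , f) ∷ cs) ++ colours K′)    ≡⟨ cong₂ (λ w x → w + ω * x) (sym (m∸n+n≡m ωq≤W)) (length-++ ((t , f) ∷ cs)) ⟩
      (W ∸ ω * Q) + ω * Q + ω * (suc (length cs) + length (colours K′)) ≤⟨ +-monoʳ-≤ ((W ∸ ω * Q) + ω * Q) (*-monoʳ-≤ ω (+-monoˡ-≤ _ cw)) ⟩
      (W ∸ ω * Q) + ω * Q + ω * (Q + length (colours K′)) ≡⟨ lem (W ∸ ω * Q) ω Q (length (colours K′)) ⟩
      (W ∸ ω * Q) + ω * length (colours K′) + 2 * (ω * Q) ∎))
      where
      lem : ∀ r w q x → r + w * q + w * (q + x) ≡ r + w * x + 2 * (w * q)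
      lem r w q x = solve (r ∙ w ∙ q ∙ x ∙ ε)
    respond : ∀ {t b} → t ∈ ts × b ∈ R → Σ[ c ∈ Fin n ] ((c ≢ t) × (c ≢ b) × AbsorbingAny (W ∸ ω * Q) (triple t b c ∷ E))
    respond (t∈ , b∈) with ∈-map⁻ proj₁ t∈
    ... | (t , f) , tf∈ , refl with find (∈-concatMap⁻ proj₂ {xs = K} tf∈)
    ...   | (w , cs) , wcs∈ , tf∈cs = finish (recolour (proj₂ (pick tf∈cs)) (permute (proj₂ (pick wcs∈)) A))
      (suc-injective (trans (sym (↭-length (proj₂ (pick wcs∈)))) K≡)) b∈

  step₃ : ∀ {W E} → AbsorbingAny W E → Absorbed E ⊎ Progress AbsorbingAny d W E
  step₃ {W} {E} ([] , absorbing h tail path R covers gR _ _ _ _ _ _ reserve) =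
    inj₁ (absorbed h tail path R (subst (λ R → h ∷ tail ++ R ↭ base) (++-identityʳ R) covers) gR
      (≤-trans (≤-trans (*-mono-≤ {3} {34} {1} {g} (m≤m+n 3 31) 1≤g) (m≤m+n (34 * g) 0)) (≤-trans reserve (≤-reflexive (+-identityʳ _)))))
  step₃ {W} {E} (K@(_ ∷ K₀) , A) = inj₂ (decide (any? (λ wc → length (proj₂ wc) <? q (length K)) K))
    where
    decide : Dec (Any (λ wc → length (proj₂ wc) < q (length K)) K) → Progress AbsorbingAny d W E
    decide (no ¬some) = linkAll A refl (All.tabulate λ wc∈ → ≮⇒≥ λ cs< → ¬some (lose wc∈ cs<))
    decide (yes some) with find some
    ... | (w , cs) , wcs∈ , cs<q = colour (permute (proj₂ (pick wcs∈)) A)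
      (subst (λ κ → length cs < q κ) (↭-length (proj₂ (pick wcs∈))) cs<q)

  phase₃ : ∀ {E} K G → Path E x₀ [] x₀ → x₀ ∷ G ++ K ↭ base → All Good G → length K ≤ g →
    34 * g + 3 * length K ≤ length G → Wins Absorbed (16 * ω * n + n) E (suc (ω * q 1))
  phase₃ {E} K G path covers good-G few reserve = drift {S = AbsorbingAny} step₃ (uncoloured ,
      absorbing x₀ [] path G (↭-trans (↭-reflexive (cong (λ l → x₀ ∷ G ++ l) vertices)) covers) good-G
        (subst (All (Good ∘ proj₁)) (sym no-colours) []) (subst (All (Good ∘ proj₂)) (sym no-colours) [])
        (subst (_≤ g) (sym size) few) (All.map⁺ (All.tabulate λ _ → z≤n)) (All.map⁺ (All.tabulate λ _ → [])) budget reserve′)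
    where
    uncoloured : List (Coloured n)
    uncoloured = map (_, []) K
    size : length uncoloured ≡ length K
    size = length-map (_, []) K
    none : ∀ (K : List (Fin n)) → colours (map (_, []) K) ≡ []
    none []      = refl
    none (_ ∷ K) = none K
    no-colours : colours uncoloured ≡ []
    no-colours = none K
    firsts : ∀ (K : List (Fin n)) → map proj₁ (map {B = Coloured n} (_, []) K) ≡ K
    firsts []      = refl
    firsts (w ∷ K) = cong (w ∷_) (firsts K)
    vertices : map proj₁ uncoloured ++ map proj₁ (colours uncoloured) ++ map proj₂ (colours uncoloured) ≡ K
    vertices = trans (cong₂ (λ l cs → l ++ map proj₁ cs ++ map proj₂ cs) (firsts K) no-colours) (++-identityʳ K)
    K≤n : length K ≤ n
    K≤n = ≤-trans few (≤-trans (m≤n*m g 100) 100g≤n)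
    budget : Y (length uncoloured) ≤ 16 * ω * n + ω * length (colours uncoloured)
    budget = ≤-trans (≤-trans (*-monoʳ-≤ (8 * ω) (+-mono-≤ (≤-trans (≤-reflexive size) K≤n)
        (s-least {length uncoloured} (*-monoˡ-≤ n (≤-trans (≤-reflexive size) K≤n))))) (≤-reflexive (lem ω n))) (m≤m+n _ _)
      where
      lem : ∀ w n → 8 * w * (n + n) ≡ 16 * w * n
      lem w n = solve (w ∙ n ∙ ε)
    reserve′ : 34 * g + 3 * length uncoloured ≤ length G + 2 * length (colours uncoloured)
    reserve′ = ≤-trans (≤-reflexive (cong (λ κ → 34 * g + 3 * κ) size)) (≤-trans reserve (m≤m+n _ _))

-- Using up the free fillers and closing the cycle

Path-end : ∀ {n} {E : Edges n} {u vs v} → Path E u vs v → v ∈ u ∷ vs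
Path-end stop    = here refl
Path-end (e ∷ p) = there (there (Path-end p))

endpoint∈ : ∀ {n k} (xs : Vec (Fin n) (suc k)) → endpoint xs ∈ toList xs
endpoint∈ (x ∷ [])     = here refl
endpoint∈ (x ∷ y ∷ xs) = there (endpoint∈ (y ∷ xs))

module Closing (n g ω : ℕ) (1≤g : 1 ≤ g) (100g≤n : 100 * g ≤ n)
  (ω-large : 2 * (n * n) ≤ ω * (g * g)) {k : ℕ} (x₀ : Fin n) (xs : Vec (Fin n) k) (E₀ : Edges n)
  {Fit : Fin k → Fin n → Set} {Good : Fin n → Set}
  (fit-edge : ∀ {i f} → Fit i f → triple (left (x₀ ∷ xs) i) f (right (x₀ ∷ xs) i) ∈ E₀)
  (expanding : Expanding Fit Good (2 * g)) where

  open Phases n g ω 1≤g 100g≤n ω-large using (enough-pairs; unique-V; length-V)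
  open ++-Solver {n} using (_⊕_; _⊜_) renaming (solve to solve-↭)
  open Engine expanding

  Filling : Set
  Filling = Vec (Fin n) k

  g≤2g : g ≤ 2 * g
  g≤2g = m≤m+n g _

  Freed : Filling → List (Fin n) → List (Fin n) → Filling → Set
  Freed M L L′ M′ = Matching M′ × (toList M′ ++ L′ ↭ toList M ++ L)

  -- Two successive exchanges: `w₁` for one of at least `2 * g - g` vertices outside `avoid`, then
  -- `w₂` for one of at least `2 * g`. The two results are free simultaneously, hence distinct.
  freeable : ∀ M → Matching M → ∀ {w₁ w₂ L} → Good w₁ → Good w₂ → Unique (toList M ++ w₁ ∷ w₂ ∷ L) →
    ∀ avoid → length avoid ≤ g → Pairs (g * g) (λ a b → (a ∉ avoid) × Good a × Good b × (Σ[ M′ ∈ Filling ] Freed M (w₁ ∷ w₂ ∷ L) (a ∷ b ∷ L) M′))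
  freeable M matching {w₁} {w₂} {L} good₁ good₂ u avoid avoid≤g =
    result₂ (dependentPairs (Unique.filter⁺ (λ a → ¬? (a ∈ᵛ? avoid)) uS) (All.tabulate second))
    where
    first = exchangeable M matching w₁ (w₂ ∷ L) good₁ u
    S  = proj₁ first
    uS = proj₁ (proj₂ first)
    S′ = filter (λ a → ¬? (a ∈ᵛ? avoid)) S
    Result : Fin n → Fin n → Set
    Result a b = (a ∉ avoid) × Good a × Good b × (Σ[ M′ ∈ Filling ] Freed M (w₁ ∷ w₂ ∷ L) (a ∷ b ∷ L) M′)
    g≤S′ : g ≤ length S′
    g≤S′ = +-cancelˡ-≤ g _ _ (≤-trans (≤-reflexive (cong (g +_) (sym (+-identityʳ g)))) (≤-trans (proj₁ (proj₂ (proj₂ first)))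
      (≤-trans (≤-reflexive (length-filter-split (_∈ᵛ? avoid) S))
        (+-monoˡ-≤ (length S′) (≤-trans (unique-length-≤ (Unique.filter⁺ (_∈ᵛ? avoid) uS)
          (λ a∈ → proj₂ (∈-filter⁻ (_∈ᵛ? avoid) {xs = S} a∈))) avoid≤g)))))
    second : ∀ {a} → a ∈ S′ → Σ[ T ∈ List (Fin n) ] (Unique T × 2 * g ≤ length T × All (λ b → a ≢ b × Result a b) T)
    second {a} a∈ with ∈-filter⁻ (λ a → ¬? (a ∈ᵛ? avoid)) {xs = S} a∈
    ... | a∈S , a∉ with All.lookup (proj₂ (proj₂ (proj₂ first))) a∈S
    ...   | good-a , M₁ , matching₁ , perm₁ with exchangeable M₁ matching₁ w₂ (a ∷ L) good₂
                (unique-↭ (↭-trans (↭-sym perm₁) (++⁺ˡ (toList M₁) (swap a w₂ ↭-refl))) u)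
    ...     | T , uT , 2g≤T , exs = T , uT , 2g≤T , All.map (λ {b} → λ where
              (good-b , M₂ , matching₂ , perm₂) →
                let perm : toList M₂ ++ a ∷ b ∷ L ↭ toList M ++ w₁ ∷ w₂ ∷ L
                    perm = ↭-trans (++⁺ˡ (toList M₂) (swap a b ↭-refl)) (↭-trans perm₂ (↭-trans (++⁺ˡ (toList M₁) (swap w₂ a ↭-refl)) perm₁))
                in (All.lookup (unique-head (unique-++ʳ (toList M₂) (unique-↭ (↭-sym perm) u))) (here refl)) ,
                   a∉ , good-a , good-b , M₂ , matching₂ , perm) exs
      where
      unique-head : ∀ {x} {ys : List (Fin n)} → Unique (x ∷ ys) → All (x ≢_) ys
      unique-head (x∉ ∷ _) = x∉
    result₂ : Σ[ P ∈ Pairs (length S′ * (2 * g)) Result ] All (λ p → proj₁ p ∈ S′) (Pairs.pairs P) → Pairs (g * g) Result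
    result₂ (mkPairs ps u p size sound , _) = mkPairs ps u p (≤-trans (*-mono-≤ g≤S′ g≤2g) size) sound

  -- Each prolongation uses up two free fillers; the last three become, after exchanges, the `t`,
  -- `f` and `b` that close the cycle.
  record Extending (r : ℕ) (E : Edges n) : Set where
    constructor extending
    field
      older    : ∀ {e} → e ∈ E₀ → e ∈ E
      h        : Fin n
      tail     : List (Fin n)
      path     : Path E h tail x₀
      M        : Filling
      matching : Matching M
      L        : List (Fin n)
      good-L   : All Good L
      L≡       : length L ≡ 3 + 2 * r
      covers   : (toList M ++ L) ++ h ∷ tail ++ toList xs ↭ allFin n

  Extending₄ : ℕ → Edges n → Set
  Extending₄ W E = Σ[ r ∈ ℕ ] (ω * r ≤ W × Extending r E)

  step₄ : ∀ {W E} → Extending₄ W E → Extending 0 E ⊎ Progress Extending₄ (suc ω) W E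
  step₄ (zero , _ , s) = inj₁ s
  step₄ {W} {E} (suc r , ωr≤W , extending older h tail path M matching (w₁ ∷ w₂ ∷ L) (good₁ ∷ good₂ ∷ good-L) L≡ covers) =
    inj₂ (advance ω (ω * r) (m≤n+m ω 2) (≤-trans (≤-reflexive (trans (+-comm _ ω) (sym (*-suc ω r)))) ωr≤W) (enough-pairs ≤-refl)
      (freeable M matching {L = L} good₁ good₂ (unique-++ˡ (toList M ++ w₁ ∷ w₂ ∷ L) (unique-V covers)) [] z≤n) respond)
    where
    respond : ∀ {a b} → (a ∉ []) × Good a × Good b × (Σ[ M′ ∈ Filling ] Freed M (w₁ ∷ w₂ ∷ L) (a ∷ b ∷ L) M′) →
      Σ[ c ∈ Fin n ] ((c ≢ a) × (c ≢ b) × Extending₄ (ω * r) (triple a b c ∷ E))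
    respond {a} {b} (_ , _ , _ , M′ , matching′ , perm) = h , h≢ (here refl) , h≢ (there (here refl)) , r , ≤-refl ,
      extending (there ∘ older) b (a ∷ h ∷ tail) (here (triple-swap b a h) ∷ Path-⊆ there path) M′ matching′ L good-L
        (suc-injective (suc-injective (trans L≡ (lem r)))) covers″
      where
      lem : ∀ r → 3 + 2 * suc r ≡ 2 + (3 + 2 * r)
      lem r = solve (r ∙ ε)
      covers′ : (toList M′ ++ a ∷ b ∷ L) ++ h ∷ tail ++ toList xs ↭ allFin n
      covers′ = ↭-trans (++⁺ʳ (h ∷ tail ++ toList xs) perm) covers
      h≢ : ∀ {y} → y ∈ a ∷ b ∷ L → h ≢ y
      h≢ y∈ eq = unique-disjoint (toList M′ ++ a ∷ b ∷ L) (unique-V covers′) (∈-++⁺ʳ (toList M′) y∈) (here refl) (sym eq)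
      covers″ : (toList M′ ++ L) ++ b ∷ (a ∷ h ∷ tail) ++ toList xs ↭ allFin n
      covers″ = ↭-trans (solve-↭ 5 (λ m l b a r → ((m ⊕ l) ⊕ (b ⊕ (a ⊕ r))) ⊜ ((m ⊕ (a ⊕ (b ⊕ l))) ⊕ r)) ↭-refl
        (toList M′) L [ b ] [ a ] (h ∷ tail ++ toList xs)) covers′

  phase₄ : ∀ {r E} → r ≤ n → Extending r E → Wins (Extending 0) (ω * n + n) E (suc ω)
  phase₄ {r} r≤n s = drift {S = Extending₄} step₄ (r , *-monoʳ-≤ ω r≤n , s)

  module _ (M : Filling) (L : List (Fin n)) (h : Fin n) where

    -- Exchanging w for any b, the edge {t, b, endpoint} completes a stub to a loose Hamilton cycle.
    record Stub (E : Edges n) (t : Fin n) : Set where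
      constructor stub
      field
        f w      : Fin n
        M′       : Filling
        edge     : triple t f h ∈ E
        good-w   : Good w
        freed    : Freed M L (w ∷ t ∷ f ∷ []) M′

    Stub-there : ∀ {E e t} → Stub E t → Stub (e ∷ E) t
    Stub-there (stub f w M′ edge good-w freed) = stub f w M′ (there edge) good-w freed

  -- Stubs are alternatives to each other: all are exchanges from the same filling `M`, and the path
  -- stays as it is until one of them is used.
  record Stubs (r : ℕ) (E : Edges n) : Set where
    constructor stubs
    field
      extended : Extending 0 E
      ts       : List (Fin n)
      unique   : Unique ts
      all-stub : All (Stub (Extending.M extended) (Extending.L extended) (Extending.h extended) E) ts
      ts+r     : length ts + r ≡ g

  -- The budget holds one `ω` for each missing stub and one for the closing offer.
  Closing₅ : ℕ → Edges n → Set
  Closing₅ W E = HasLooseHC E ⊎ (Σ[ r ∈ ℕ ] (ω * suc r ≤ W × Stubs r E))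

  there-extended : ∀ {r E e} → Extending r E → Extending r (e ∷ E)
  there-extended (extending older h tail path M matching L good-L L≡ covers) =
    extending (there ∘ older) h tail (Path-⊆ there path) M matching L good-L L≡ covers

  addStub : ∀ {r W E} → ω * suc (suc r) ≤ W → Stubs (suc r) E → Progress Closing₅ (suc ω) W E
  addStub {r} {W} {E} ωr≤W (stubs s@(extending older h tail path M matching (w₁ ∷ w₂ ∷ w₃ ∷ []) (good₁ ∷ good₂ ∷ good₃ ∷ []) refl covers) ts uts sts ts+r) =
    advance ω (ω * suc r) (m≤n+m ω 2) (≤-trans (≤-reflexive (trans (+-comm _ ω) (sym (*-suc ω (suc r))))) ωr≤W) (enough-pairs ≤-refl)
      (freeable M matching {L = w₃ ∷ []} good₁ good₂ (unique-++ˡ (toList M ++ w₁ ∷ w₂ ∷ w₃ ∷ []) (unique-V covers)) ts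
        (≤-trans (m≤m+n (length ts) (suc r)) (≤-reflexive ts+r))) respond
    where
    respond : ∀ {a b} → (a ∉ ts) × Good a × Good b × (Σ[ M′ ∈ Filling ] Freed M (w₁ ∷ w₂ ∷ w₃ ∷ []) (a ∷ b ∷ w₃ ∷ []) M′) →
      Σ[ c ∈ Fin n ] ((c ≢ a) × (c ≢ b) × Closing₅ (ω * suc r) (triple a b c ∷ E))
    respond {a} {b} (a∉ , _ , _ , M′ , matching′ , perm) = h , h≢ (here refl) , h≢ (there (here refl)) , inj₂ (r , ≤-refl ,
      stubs (there-extended s) (a ∷ ts) (All.tabulate (λ t∈ eq → a∉ (subst (_∈ ts) (sym eq) t∈)) ∷ uts)
        (stub b w₃ M′ (here refl) good₃ (matching′ , ↭-trans (++⁺ˡ (toList M′) (↭-sym (shift w₃ (a ∷ b ∷ []) []))) perm) ∷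
          All.map (Stub-there M (w₁ ∷ w₂ ∷ w₃ ∷ []) h) sts)
        (trans (sym (+-suc (length ts) r)) ts+r))
      where
      h≢ : ∀ {y} → y ∈ a ∷ b ∷ w₃ ∷ [] → h ≢ y
      h≢ y∈ eq = unique-disjoint (toList M′ ++ a ∷ b ∷ w₃ ∷ []) (unique-V (↭-trans (++⁺ʳ (h ∷ tail ++ toList xs) perm) covers))
        (∈-++⁺ʳ (toList M′) y∈) (here refl) (sym eq)

  -- A single stub would be completed by only linearly many offers; `g` stubs with at least `2 * g`
  -- choices of `b` each give quadratically many.
  closeUp : ∀ {W E} → ω * 1 ≤ W → Stubs 0 E → Progress Closing₅ (suc ω) W E
  closeUp {W} {E} ω≤W (stubs (extending older h tail path M matching L good-L L≡ covers) ts uts sts ts+r) =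
    advance ω 0 (m≤n+m ω 2) (≤-trans (≤-reflexive (sym (*-identityʳ ω))) ω≤W)
      (enough-pairs (*-mono-≤ (≤-reflexive (trans (sym ts+r) (+-identityʳ _))) g≤2g))
      (proj₁ (dependentPairs uts (All.map second sts))) respond
    where
    Result : Fin n → Fin n → Set
    Result t b = Σ[ f ∈ Fin n ] Σ[ M″ ∈ Filling ] (triple t f h ∈ E × Freed M L (b ∷ t ∷ f ∷ []) M″)
    second : ∀ {t} → Stub M L h E t → Σ[ T ∈ List (Fin n) ] (Unique T × 2 * g ≤ length T × All (λ b → t ≢ b × Result t b) T)
    second {t} (stub f w M′ edge good-w (matching′ , perm)) with exchangeable M′ matching′ w (t ∷ f ∷ []) good-w
        (unique-↭ (↭-sym perm) (unique-++ˡ (toList M ++ L) (unique-V covers)))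
    ... | T , uT , 2g≤T , exs = T , uT , 2g≤T , All.map (λ {b} → λ where
        (_ , M″ , matching″ , perm″) → (λ eq → unique-b (unique-++ʳ (toList M″) (unique-↭ (↭-sym (↭-trans perm″ perm))
            (unique-++ˡ (toList M ++ L) (unique-V covers)))) (sym eq)) ,
          f , M″ , edge , matching″ , ↭-trans perm″ perm) exs
      where
      unique-b : ∀ {x y : Fin n} {zs} → Unique (x ∷ y ∷ zs) → x ≢ y
      unique-b ((x≢y ∷ _) ∷ _) = x≢y
    z = endpoint (x₀ ∷ xs)
    z∈ : z ∈ h ∷ tail ++ toList xs
    z∈ with endpoint∈ (x₀ ∷ xs)
    ... | here eq = subst (_∈ h ∷ tail ++ toList xs) (sym eq) (∈-++⁺ˡ (Path-end path))
    ... | there p = ∈-++⁺ʳ (h ∷ tail) p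
    respond : ∀ {t b} → Result t b → Σ[ c ∈ Fin n ] ((c ≢ t) × (c ≢ b) × Closing₅ 0 (triple t b c ∷ E))
    respond {t} {b} (f , M″ , edge , matching″ , perm) = z , z≢ (there (here refl)) , z≢ (here refl) ,
      inj₁ (closeCycle (Path-⊆ there path ⟫ weavePath (x₀ ∷ xs) M″ (λ i → there (older (fit-edge (matching″ i)))))
        (there edge) (here (triple-rev z b t)) cycle)
      where
      covers′ : (toList M″ ++ b ∷ t ∷ f ∷ []) ++ h ∷ tail ++ toList xs ↭ allFin n
      covers′ = ↭-trans (++⁺ʳ (h ∷ tail ++ toList xs) perm) covers
      z≢ : ∀ {y} → y ∈ b ∷ t ∷ f ∷ [] → z ≢ y
      z≢ y∈ eq = unique-disjoint (toList M″ ++ b ∷ t ∷ f ∷ []) (unique-V covers′) (∈-++⁺ʳ (toList M″) y∈) z∈ (sym eq)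
      cycle : t ∷ f ∷ h ∷ (tail ++ weave (x₀ ∷ xs) M″) ++ [ b ] ↭ allFin n
      cycle = ↭-trans (prep t (prep f (prep h (++⁺ʳ [ b ] (++⁺ˡ tail (drop-∷ (weave-↭ (x₀ ∷ xs) M″)))))))
        (↭-trans (solve-↭ 7 (λ t f h l x m b → (t ⊕ (f ⊕ (h ⊕ ((l ⊕ (x ⊕ m)) ⊕ b)))) ⊜ ((m ⊕ (b ⊕ (t ⊕ f))) ⊕ (h ⊕ (l ⊕ x)))) ↭-refl
          [ t ] [ f ] [ h ] tail (toList xs) (toList M″) [ b ]) covers′)

  step₅ : ∀ {W E} → Closing₅ W E → HasLooseHC E ⊎ Progress Closing₅ (suc ω) W E
  step₅ (inj₁ hc)                      = inj₁ hc
  step₅ (inj₂ (zero  , ω≤W , s))       = inj₂ (closeUp ω≤W s)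
  step₅ (inj₂ (suc r , ωr≤W , s))      = inj₂ (addStub ωr≤W s)

  phase₅ : ∀ {E} → Extending 0 E → Wins HasLooseHC (ω * n + n) E (suc ω)
  phase₅ s = drift {S = Closing₅} step₅ (inj₂ (g , *-monoʳ-≤ ω (≤-trans (+-mono-≤ 1≤g (m≤n*m g 99)) 100g≤n) , stubs s [] [] [] refl))

-- Assembling the strategy

filter-↭-split : ∀ {A : Set} {P : A → Set} (P? : Decidable P) xs →
  xs ↭ filter (λ x → ¬? (P? x)) xs ++ filter P? xs
filter-↭-split P? [] = ↭-refl
filter-↭-split P? (x ∷ xs) with P? x
... | yes _ = ↭-trans (prep x (filter-↭-split P? xs)) (↭-sym (shift x (filter (λ x → ¬? (P? x)) xs) (filter P? xs)))
... | no _  = prep x (filter-↭-split P? xs)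

odd-or-even : ∀ l → 3 ≤ l → (Σ[ r ∈ ℕ ] (l ≡ 3 + 2 * r)) ⊎ (Σ[ r ∈ ℕ ] (l ≡ 4 + 2 * r))
odd-or-even 3 _ = inj₁ (0 , refl)
odd-or-even 4 _ = inj₂ (0 , refl)
odd-or-even (suc (suc (suc (suc (suc l))))) _ with odd-or-even (3 + l) (s≤s (s≤s (s≤s z≤n)))
... | inj₁ (r , eq) = inj₁ (suc r , trans (cong (2 +_) eq) (cong (3 +_) (sym (*-suc 2 r))))
... | inj₂ (r , eq) = inj₂ (suc r , trans (cong (2 +_) eq) (cong (4 +_) (sym (*-suc 2 r))))
odd-or-even 0 ()
odd-or-even 1 (s≤s ())
odd-or-even 2 (s≤s (s≤s ()))

module Assembly (n g ω : ℕ) (1≤g : 1 ≤ g) (100g≤n : 100 * g ≤ n) (n≤200g : n ≤ 200 * g)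
  (ω-large : 2 * (n * n) ≤ ω * (g * g)) (half : ℕ) (n-even : n ≡ 2 * half) where

  open Phases n g ω 1≤g 100g≤n ω-large
  open Scale n using (q)
  open ++-Solver {n} using (_⊕_; _⊜_) renaming (solve to solve-↭)

  1≤ω : 1 ≤ ω
  1≤ω = n≢0⇒n>0 λ ω≡0 → <⇒≱ (*-mono-≤ {1} {2} {1} {n * n} (s≤s z≤n) (*-mono-≤ {1} {n} {1} {n} 1≤n 1≤n))
      (≤-trans ω-large (≤-reflexive (cong (_* (g * g)) ω≡0)))
    where
    1≤n : 1 ≤ n
    1≤n = n≢0⇒n>0 n≢0

  module AfterChain (x₀ : Fin n) (xs : Vec (Fin n) k) (ms : Vec (Fin n) k) (free : List (Fin n))
    (all : toList (x₀ ∷ xs) ++ toList ms ++ free ↭ allFin n) where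

    F : List (Fin n)
    F = toList ms ++ free

    open Fillers n g ω ω-large (x₀ ∷ xs) F all using (Fill; Mixing) public
    open Fillers n g ω ω-large (x₀ ∷ xs) F all using (phase₂)

    4g≤k : 4 * g ≤ k
    4g≤k = *-monoˡ-≤ g (m≤m+n 4 6)

    open Expansion n g ω ω-large (x₀ ∷ xs) F all 4g≤k

    size : suc k + (k + length free) ≡ n
    size = trans (sym (trans (length-++ (toList (x₀ ∷ xs))) (cong₂ _+_ (Vec.length-toList (x₀ ∷ xs))
      (trans (length-++ (toList ms)) (cong (_+ length free) (Vec.length-toList ms)))))) (length-V all)

    phase₂′ : ∀ {E} → Wins Mixing (ω * (3 * n)) E 1
    phase₂′ = phase₂ k≤n (≤-trans (≤-trans (≤-reflexive (trans (length-++ (toList ms)) (cong (_+ length free) (Vec.length-toList ms))))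
      (m≤n+m _ (suc k))) (≤-reflexive size)) 1≤ω

    module AfterMixing (E₂ : Edges n) (mixing : Mixing E₂) (links : ∀ i → Fill E₂ i (lookup ms i)) where

      bad-free good-free base : List (Fin n)
      bad-free  = filter (_∈ᵛ? poor E₂ mixing) free
      good-free = filter (λ f → ¬? (f ∈ᵛ? poor E₂ mixing)) free
      base      = x₀ ∷ good-free ++ bad-free

      free↭ : free ↭ good-free ++ bad-free
      free↭ = filter-↭-split (_∈ᵛ? poor E₂ mixing) free

      base↭ : base ++ toList xs ++ toList ms ↭ allFin n
      base↭ = ↭-trans (prep x₀ (↭-trans (++⁺ʳ (toList xs ++ toList ms) (↭-sym free↭))
        (solve-↭ 3 (λ f x m → (f ⊕ (x ⊕ m)) ⊜ (x ⊕ (m ⊕ f))) ↭-refl free (toList xs) (toList ms)))) all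

      unique-base : Unique base
      unique-base = unique-++ˡ base (unique-V base↭)

      unique-free : Unique free
      unique-free = unique-++ʳ (toList ms) (unique-++ʳ (toList (x₀ ∷ xs)) (unique-V all))

      good-free-good : All (Good E₂ mixing) good-free
      good-free-good = All.tabulate λ f∈ → case ∈-filter⁻ (λ f → ¬? (f ∈ᵛ? poor E₂ mixing)) {xs = free} f∈ of λ where
        (f∈free , f∉) → ∈-++⁺ʳ (toList ms) f∈free , f∉

      few : length bad-free ≤ g
      few = ≤-trans (unique-length-≤ (Unique.filter⁺ (_∈ᵛ? poor E₂ mixing) unique-free)
        (λ f∈ → proj₂ (∈-filter⁻ (_∈ᵛ? poor E₂ mixing) {xs = free} f∈))) (<⇒≤ (poor-few E₂ mixing))

      -- At least `80 * g - 1` vertices are free after the chain, and at most `g` of them are poor.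
      reserve : 34 * g + 3 * length bad-free ≤ length good-free
      reserve = lin (41 * g) (+-mono-≤ 100g≤n (+-mono-≤ (*-monoʳ-≤ 4 few) (+-mono-≤ 1≤g
          (≤-reflexive (trans (sym size) (cong (λ f → suc k + (k + f)) (trans (↭-length free↭) (length-++ good-free))))))))
        (lem g n (length good-free) (length bad-free))
        where
        lem : ∀ g n a b → 34 * g + 3 * b + (n + (4 * g + (g + (suc (10 * g) + (10 * g + (a + b)))))) + 41 * g ≡
          a + (100 * g + (4 * b + (1 + n)))
        lem g n a b = solve (g ∙ n ∙ a ∙ b ∙ ε)

      open Absorption n g ω 1≤g 100g≤n n≤200g ω-large (Good E₂ mixing) x₀ base unique-base
      open Closing n g ω 1≤g 100g≤n ω-large x₀ xs E₂ {Fit E₂} {Good E₂ mixing} proj₂ (expanding E₂ mixing)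

      -- The path has an odd number of vertices, because `Path-even` counts those after the head,
      -- and the chain contributes `2 * k` more. As `n` is even, the rest is odd.
      parity : ∀ {E} (a : Absorbed E) → Σ[ r ∈ ℕ ] (length (Absorbed.R a) ≡ 3 + 2 * r)
      parity (absorbed h tail path R covers good-R plenty) with odd-or-even (length R) plenty
      ... | inj₁ odd = odd
      ... | inj₂ (r , eq) with Path-even path
      ...   | p , tail≡ = ⊥-elim (even≢odd half (k + p + r + 2) (trans (sym n-even) (trans (sym total) (lem k p r))))
        where
        total : suc (2 * p + (4 + 2 * r)) + (k + k) ≡ n
        total = trans (sym (trans (length-++ base) (cong₂ _+_ (trans (sym (↭-length covers)) (cong suc
            (trans (length-++ tail) (cong₂ _+_ tail≡ eq)))) (trans (length-++ (toList xs)) (cong₂ _+_ (Vec.length-toList xs) (Vec.length-toList ms))))))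
          (length-V base↭)
        lem : ∀ k p r → suc (2 * p + (4 + 2 * r)) + (k + k) ≡ suc (2 * (k + p + r + 2))
        lem k p r = solve (k ∙ p ∙ r ∙ ε)

      extendable : ∀ {E} → (∀ {e} → e ∈ E₂ → e ∈ E) → (a : Absorbed E) → ∀ {r} → length (Absorbed.R a) ≡ 3 + 2 * r → Extending r E
      extendable older (absorbed h tail path R covers good-R _) R≡ =
        extending older h tail path ms (λ i → ∈-++⁺ˡ (lookup∈ ms i) , links i) R good-R R≡
          (↭-trans (solve-↭ 4 (λ m r h x → ((m ⊕ r) ⊕ (h ⊕ x)) ⊜ ((h ⊕ r) ⊕ (x ⊕ m))) ↭-refl (toList ms) R (h ∷ tail) (toList xs))
            (↭-trans (++⁺ʳ (toList xs ++ toList ms) covers) base↭))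

      r≤n : ∀ {E} (a : Absorbed E) {r} → length (Absorbed.R a) ≡ 3 + 2 * r → r ≤ n
      r≤n (absorbed h tail path R covers _ _) {r} R≡ = begin
        r                                       ≤⟨ m≤m+n r _ ⟩
        2 * r                                   ≤⟨ m≤n+m _ 3 ⟩
        3 + 2 * r                               ≡⟨ sym R≡ ⟩
        length R                                ≤⟨ m≤n+m _ (length (h ∷ tail)) ⟩
        length (h ∷ tail) + length R            ≡⟨ sym (length-++ (h ∷ tail)) ⟩
        length (h ∷ tail ++ R)                  ≡⟨ ↭-length covers ⟩
        length base                             ≤⟨ m≤m+n _ _ ⟩
        length base + length (toList xs ++ toList ms) ≡⟨ sym (length-++ base) ⟩
        length (base ++ toList xs ++ toList ms) ≡⟨ length-V base↭ ⟩
        n                                       ∎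
        where open ≤-Reasoning

      finish : Wins HasLooseHC ((16 * ω * n + n) + ((ω * n + n) + (ω * n + n))) E₂ (suc (ω * q 1) + (suc ω + suc ω))
      finish = keeping (16 * ω * n + n) (phase₃ bad-free good-free stop ↭-refl good-free-good few reserve) then λ (older , a) →
        complete older a (parity a)
        where
        complete : ∀ {E} → (∀ {e} → e ∈ E₂ → e ∈ E) → (a : Absorbed E) → Σ[ r ∈ ℕ ] (length (Absorbed.R a) ≡ 3 + 2 * r) →
          Wins HasLooseHC ((ω * n + n) + (ω * n + n)) E (suc ω + suc ω)
        complete older a (r , R≡) = phase₄ (r≤n a {r} R≡) (extendable older a R≡) then phase₅

  T : ℕ
  T = (ω * n + n) + (ω * (3 * n) + ((16 * ω * n + n) + ((ω * n + n) + (ω * n + n))))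

  errors : ℕ
  errors = suc ω + (1 + (suc (ω * q 1) + (suc ω + suc ω)))

  afterChain : ∀ {E} → Chain k E → Wins HasLooseHC (ω * (3 * n) + ((16 * ω * n + n) + ((ω * n + n) + (ω * n + n)))) E
    (1 + (suc (ω * q 1) + (suc ω + suc ω)))
  afterChain (chain (x₀ ∷ xs) ms free links all) = keeping (ω * (3 * n)) phase₂′ then λ {E₂} (older , mixing) →
      AfterMixing.finish E₂ mixing (λ i → older (links i))
    where open AfterChain x₀ xs ms free all

  win : Wins HasLooseHC T [] errors
  win = phase₁ then afterChain

-- From failure bounds to asymptotically almost sure success

hasLooseHC-⊆ : ∀ {n} {E H : Edges n} → (∀ {e} → e ∈ E → e ∈ H) → HasLooseHC E → HasLooseHC H
hasLooseHC-⊆ E⊆H (vs , vs↭ , es) = vs , vs↭ , All.map E⊆H es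

module Final (ω : ℕ) (ω-large : ∀ n g → n ≤ 200 * g → 2 * (n * n) ≤ ω * (g * g)) where

  c : ℕ
  c = 22 * ω + 4

  errors : ℕ → ℕ
  errors n = suc ω + (1 + (suc (ω * Scale.q n 1) + (suc ω + suc ω)))

  Playable : ℕ → Set
  Playable n = (100 ≤ n) × (2 ∣ n)

  win : ∀ {n} → Playable n → Wins {n} HasLooseHC (c * n) [] (errors n)
  win {n} (100≤n , divides half n≡) = subst (λ T → Wins {n} HasLooseHC T [] (errors n)) (lem ω n)
      (Assembly.win n g ω 1≤g 100g≤n n≤200g (ω-large n g n≤200g) half (trans n≡ (*-comm half 2)))
    where
    open ≤-Reasoning
    g : ℕ
    g = n / 100
    1≤g : 1 ≤ g
    1≤g = m≥n⇒m/n>0 100≤n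
    100g≤n : 100 * g ≤ n
    100g≤n = ≤-trans (≤-reflexive (*-comm 100 g)) (m/n*n≤m n 100)
    n≤200g : n ≤ 200 * g
    n≤200g = begin
      n                     ≡⟨ m≡m%n+[m/n]*n n 100 ⟩
      n % 100 + g * 100     ≤⟨ +-monoˡ-≤ (g * 100) (<⇒≤ (m%n<n n 100)) ⟩
      100 + g * 100         ≤⟨ +-monoˡ-≤ (g * 100) (*-monoˡ-≤ 100 1≤g) ⟩
      g * 100 + g * 100     ≡⟨ sym (*-distribˡ-+ g 100 100) ⟩
      g * 200               ≡⟨ *-comm g 200 ⟩
      200 * g               ∎
    lem : ∀ w n → (w * n + n) + (w * (3 * n) + ((16 * w * n + n) + ((w * n + n) + (w * n + n)))) ≡ (22 * w + 4) * n
    lem w n = solve (w ∙ n ∙ ε)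

  playable? : ∀ n → Dec (Playable n)
  playable? n = (100 ≤? n) ×-dec (2 ∣? n)

  σ′ : ∀ {n} → Dec (Playable n) → Strategy n
  σ′ {n} (yes p) = strategy (c * n) (tree (win p))
  σ′     (no _)  = λ _ _ → nothing

  σ : ∀ n → Strategy n
  σ n = σ′ (playable? n)

  -- `q 1` is `√n` rounded up, hence at most `2√n`; the bound on `n` absorbs this factor 2.
  q-sublinear : ∀ B n → 2 * B * (2 * B) ≤ n → 1 ≤ n → B * Scale.q n 1 ≤ n
  q-sublinear B n 4B²≤n 1≤n with Scale.q n 1 in eq
  ... | zero  = ≤-trans (≤-reflexive (*-zeroʳ B)) z≤n
  ... | suc j = bound j (<⇒≤ (≤-trans (s≤s (≤-reflexive (sym (+-identityʳ (j * j)))))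
      (Scale.q-minimal n {1} (≤-trans (s≤s ≤-refl) (≤-reflexive (sym eq))))))
    where
    m≤m*m : ∀ m → m ≤ m * m
    m≤m*m zero    = z≤n
    m≤m*m (suc m) = m≤m*n (suc m) (suc m)
    bound : ∀ j → j * j ≤ n → B * suc j ≤ n
    bound zero    _    = ≤-trans (≤-reflexive (*-identityʳ B)) (≤-trans (m≤m+n B _) (≤-trans (m≤m*m (2 * B)) 4B²≤n))
    bound (suc j) j²≤n = ≤-trans (≤-trans (m≤m+n _ (B * j)) (≤-reflexive (lem B j))) ([ case₁ , case₂ ]′ (≤-total (2 * B) (suc j)))
      where
      lem : ∀ B j → B * suc (suc j) + B * j ≡ 2 * B * suc j
      lem B j = solve (B ∙ j ∙ ε)
      case₁ : 2 * B ≤ suc j → 2 * B * suc j ≤ n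
      case₁ p = ≤-trans (*-monoˡ-≤ (suc j) p) j²≤n
      case₂ : suc j ≤ 2 * B → 2 * B * suc j ≤ n
      case₂ p = ≤-trans (*-monoʳ-≤ (2 * B) p) 4B²≤n

  A : ℕ
  A = 4 * ω + 5

  errors≤ : ∀ n → 1 ≤ Scale.q n 1 → errors n ≤ A * Scale.q n 1
  errors≤ n 1≤q = lin 0 (*-monoʳ-≤ (3 * ω + 5) 1≤q) (lem ω (Scale.q n 1))
    where
    lem : ∀ w q → suc w + (1 + (suc (w * q) + (suc w + suc w))) + (3 * w + 5) * q + 0 ≡ (4 * w + 5) * q + (3 * w + 5) * 1
    lem w q = solve (w ∙ q ∙ ε)

  1≤q : ∀ n → 1 ≤ n → 1 ≤ Scale.q n 1
  1≤q n 1≤n = n≢0⇒n>0 λ q≡0 → <⇒≱ 1≤n (≤-trans (Scale.n≤κq² n 0) (≤-reflexive (cong (λ q → 1 * (q * q)) q≡0)))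

  threshold : ℕ → ℕ
  threshold k = 100 + 2 * (k * A) * (2 * (k * A))

  few-errors : ∀ k n → threshold k ≤ n → k * errors n ≤ n
  few-errors k n N≤n = begin
    k * errors n             ≤⟨ *-monoʳ-≤ k (errors≤ n (1≤q n 1≤n)) ⟩
    k * (A * Scale.q n 1)    ≡⟨ sym (*-assoc k A _) ⟩
    k * A * Scale.q n 1      ≤⟨ q-sublinear (k * A) n (≤-trans (m≤n+m _ 100) N≤n) 1≤n ⟩
    n                        ∎
    where
    open ≤-Reasoning
    1≤n : 1 ≤ n
    1≤n = ≤-trans (m≤m+n 1 (99 + 2 * (k * A) * (2 * (k * A)))) N≤n

  almost-all : ∀ k {n} → 1 ≤ n → k * errors n ≤ n → (d : Dec (Playable n)) → Playable n →
    ∃[ L ] (Unique {A = Vec (Offer n) (c * n)} L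
      × All (λ os → HasLooseHC (Hyp (σ′ d) (toList os))) L
      × (k ∸ 1) * ((n C 2) ^ (c * n)) ≤ k * length L)
  almost-all k {n} 1≤n kq≤n (no ¬p) p = ⊥-elim (¬p p)
  almost-all k {n} 1≤n kq≤n (yes p) _ = good T t , unique-good T t , All.tabulate (λ {os} os∈ →
      hasLooseHC-⊆ (λ e∈ → case result⊆play T t os (strategy T t) [] (λ _ _ → refl) e∈ of λ { (inj₂ e∈H) → e∈H })
        (good-result T t os∈)) ,
      subst (λ N → (k ∸ 1) * N ^ T ≤ k * length (good T t)) (length-offers n) many
    where
    open ≤-Reasoning
    T = c * n
    t = tree (win p)
    N = length (offers n)
    k*bad≤ : k * bad T t ≤ N ^ T
    k*bad≤ = *-cancelʳ-≤ _ _ n {{>-nonZero 1≤n}} (begin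
      k * bad T t * n          ≡⟨ *-assoc k _ n ⟩
      k * (bad T t * n)        ≤⟨ *-monoʳ-≤ k (bad-few (win p)) ⟩
      k * (errors n * N ^ T)   ≡⟨ sym (*-assoc k _ _) ⟩
      k * errors n * N ^ T     ≤⟨ *-monoˡ-≤ (N ^ T) kq≤n ⟩
      n * N ^ T                ≡⟨ *-comm n _ ⟩
      N ^ T * n                ∎)
    many : (k ∸ 1) * N ^ T ≤ k * length (good T t)
    many = begin
      (k ∸ 1) * N ^ T                            ≡⟨ *-distribʳ-∸ (N ^ T) k 1 ⟩
      k * N ^ T ∸ 1 * N ^ T                      ≡⟨ cong₂ (λ x y → k * x ∸ y) (sym (good+bad T t)) (*-identityˡ (N ^ T)) ⟩
      k * (length (good T t) + bad T t) ∸ N ^ T  ≤⟨ ∸-monoʳ-≤ (k * (length (good T t) + bad T t)) k*bad≤ ⟩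
      k * (length (good T t) + bad T t) ∸ k * bad T t ≡⟨ cong (_∸ k * bad T t) (*-distribˡ-+ k _ _) ⟩
      k * length (good T t) + k * bad T t ∸ k * bad T t ≡⟨ m+n∸n≡m _ (k * bad T t) ⟩
      k * length (good T t)                      ∎

  -- Probability is expressed by counting: `L` lists distinct winning offer sequences and makes up
  -- at least the proportion `1 - 1/k` of all of them. As `k` is arbitrary, this is convergence to
  -- 1.
  conclusion : (k : ℕ) → 1 ≤ k → ∃[ N ] ((m : ℕ) → N ≤ m →
    ∃[ L ] (Unique {A = Vec (Offer (2 * m)) (c * (2 * m))} L
      × All (λ os → HasLooseHC (Hyp (σ (2 * m)) (toList os))) L
      × (k ∸ 1) * (((2 * m) C 2) ^ (c * (2 * m))) ≤ k * length L))
  conclusion k _ = threshold k , λ m N≤m →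
    let N≤2m = ≤-trans N≤m (m≤m+n m _)
        100≤2m = ≤-trans (m≤m+n 100 _) N≤2m
    in almost-all k (≤-trans (m≤m+n 1 99) 100≤2m) (few-errors k (2 * m) N≤2m) (playable? (2 * m))
         (100≤2m , m∣m*n m)

theorem3 : Σ ℕ λ c → Σ ((n : ℕ) → Strategy n) λ σ → ((k : ℕ) → 1 ≤ k → ∃[ N ] ((m : ℕ) → N ≤ m →
    ∃[ L ] (Unique {A = Vec (Offer (2 * m)) (c * (2 * m))} L
    × All (λ os → HasLooseHC (Hyp (σ (2 * m)) (toList os))) L
    × (k ∸ 1) * (((2 * m) C 2) ^ (c * (2 * m))) ≤ k * length L)))
theorem3 = c , σ , conclusion
  where
  ω-large : ∀ n g → n ≤ 200 * g → 2 * (n * n) ≤ 80000 * (g * g)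
  ω-large n g n≤200g = ≤-trans (*-monoʳ-≤ 2 (*-mono-≤ n≤200g n≤200g)) (≤-reflexive (lem g))
    where
    lem : ∀ g → 2 * (200 * g * (200 * g)) ≡ 80000 * (g * g)
    lem g = solve (g ∙ ε)
  open Final 80000 ω-large
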